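{- Let $\chi(\mathbb{R}^d)$ denote the chromatic number of the unit-distance graph on $\mathbb{R}^d$, i.e. the graph whose vertex set is $\mathbb{R}^d$ and in which two points $p,q$ are adjacent if and only if their Euclidean distance is exactly $1$. Then $\chi(\mathbb{R}^8) \ge 19$, $\chi(\mathbb{R}^9) \ge 21$, $\chi(\mathbb{R}^{10}) \ge 26$, $\chi(\mathbb{R}^{11}) \ge 32$, and $\chi(\mathbb{R}^{12}) \ge 32$.
   Context: The chromatic number $\chi(G)$ of a graph $G$ is the smallest integer $k$ such that there is a function $f: V(G) \to \{1,\dots,k\}$ with $f(p) \neq f(q)$ whenever $p$ and $q$ are adjacent. Here the graph $\mathbb{R}^d$ is the infinite graph on all points of $d$-dimensional Euclidean space, with edges between points at Euclidean distance exactly $1$. -}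

module Defs where

-- The standard library has no real numbers.  We therefore axiomatise ℝ as a
-- (Dedekind-)complete ordered field, with propositional equality as its
-- equality.  All such structures are isomorphic to ℝ, so quantifying over
-- every model is a faithful rendering of statements about ℝ.

open import Level using (0ℓ)
open import Data.Nat using (ℕ; zero; suc; _<_)
open import Data.Fin using (Fin)
open import Data.Product using (Σ; _×_; ∃)
open import Data.Empty using (⊥)
open import Relation.Nullary using (¬_)
open import Relation.Binary.PropositionalEquality using (_≡_; _≢_)
open import Relation.Binary.Structures using (IsTotalOrder)
open import Algebra.Structures using (IsCommutativeRing)

record CompleteOrderedField : Set₁ where
  field
    Carrier : Set
    _+_ _*_ : Carrier → Carrier → Carrier
    -_      : Carrier → Carrier
    0# 1#   : Carrier
    _≤_     : Carrier → Carrier → Set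
    isCommutativeRing : IsCommutativeRing _≡_ _+_ _*_ -_ 0# 1#
    nontrivial : 0# ≢ 1#
    inverse    : ∀ x → x ≢ 0# → Σ Carrier (λ y → x * y ≡ 1#)
    isTotalOrder : IsTotalOrder _≡_ _≤_
    +-mono-≤   : ∀ x y z → x ≤ y → (x + z) ≤ (y + z)
    *-nonneg   : ∀ x y → 0# ≤ x → 0# ≤ y → 0# ≤ (x * y)
    lub : (S : Carrier → Set) → Σ Carrier S →
          Σ Carrier (λ b → ∀ x → S x → x ≤ b) →
          Σ Carrier (λ s → (∀ x → S x → x ≤ s) ×
                           (∀ b → (∀ x → S x → x ≤ b) → s ≤ b))

module _ (R : CompleteOrderedField) where
  open CompleteOrderedField R

  sumFin : ∀ d → (Fin d → Carrier) → Carrier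
  sumFin zero    f = 0#
  sumFin (suc d) f = f Fin.zero + sumFin d (λ i → f (Fin.suc i))

  sqDist : ∀ d → (Fin d → Carrier) → (Fin d → Carrier) → Carrier
  sqDist d p q = sumFin d (λ i → (p i + (- q i)) * (p i + (- q i)))

  -- p, q adjacent in the unit-distance graph on ℝ^d  (|p - q| = 1 ⇔ |p - q|² = 1)
  UnitAdj : ∀ d → (Fin d → Carrier) → (Fin d → Carrier) → Set
  UnitAdj d p q = sqDist d p q ≡ 1#

  ProperColouring : ∀ d m → ((Fin d → Carrier) → Fin m) → Set
  ProperColouring d m f = ∀ p q → UnitAdj d p q → f p ≢ f q

  ChromaticAtLeast : ℕ → ℕ → Set
  ChromaticAtLeast d k =
    ∀ m → m < k → ¬ Σ ((Fin d → Carrier) → Fin m) (ProperColouring d m)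

{-# OPTIONS --safe #-}
module Submission where

-- All graphs live in the E₈ lattice, with lattice points at squared distance 4 adjacent.
-- Modulo 2E₈ the roots become, up to sign, the 120 nonsingular vectors of a quadratic
-- space over F₂, and two roots are orthogonal iff the polar form of their images vanishes.
-- Key fact: two sets of such vectors, each with form 1 between distinct members and with
-- form 0 between the sets, have together at most 8 elements.
--
-- Dimension 9: take two parallel copies of the 240 roots at squared distance 2.  Let a
-- colour class contain x and y roots up to sign in the two copies, p and r of them with
-- both signs.  A root present with both signs in one copy is even to everything in the
-- other, so p + y ≤ 8 and r + x ≤ 8: a class has at most 16 of the 480 points.
--
-- Dimension 11: two further points, adjacent to each other and to all 480 points, cost two
-- more colours.
--
-- Dimension 8: fix a root ρ and take the E₇ roots orthogonal to ρ, their translates by ρ,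
-- and the 56 roots having inner product 1 with ρ.  A class has at most 17 of the 308 points.

open import Defs
open import Algebra.Bundles using (CommutativeRing)
import Algebra.Properties.Ring
import Algebra.Solver.Ring.NaturalCoefficients.Default
open import Data.Bool using (Bool; true; false; T; T?; _∧_; _∨_; _xor_; not; if_then_else_)
open import Data.Bool.ListAction using (all; any)
open import Data.Bool.Properties using (T-≡; T-∧; T-∨; T-not-≡; ∧-comm; xor-identityʳ)
open import Data.Bool.Solver using (module xor-∧-Solver)
open import Data.Empty using (⊥; ⊥-elim)
open import Data.Fin using (Fin; zero; suc; toℕ)
open import Data.Fin.Properties using (toℕ<n; toℕ-injective)
open import Data.List using (List; []; _∷_; _++_; map; length; filterᵇ; take; replicate)
open import Data.List.Membership.Propositional using (_∈_)
open import Data.List.Membership.Propositional.Properties using (∈-filter⁺; ∈-map⁺; ∈-++⁺ˡ; ∈-++⁺ʳ)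
open import Data.List.Properties using (length-map; length-++; length-take; length-filter; length-replicate)
open import Data.List.Relation.Binary.Permutation.Propositional using (_↭_; ↭-refl; ↭-trans; prep; swap)
open import Data.List.Relation.Binary.Permutation.Propositional.Properties using (All-resp-↭; ↭-length)
open import Data.List.Relation.Unary.All as All using (All; []; _∷_; all?)
import Data.List.Relation.Unary.All.Properties as All
open import Data.List.Relation.Unary.AllPairs as AllPairs using (AllPairs; []; _∷_; allPairs?)
import Data.List.Relation.Unary.AllPairs.Properties as AllPairs
open import Data.List.Relation.Unary.Any using (here; there; satisfied)
import Data.List.Relation.Unary.Any.Properties as Any
open import Data.Nat using (ℕ; zero; suc; _+_; _*_; _∸_; _/_; _%_; ∣_-_∣; _≤_; _<_; z≤n; s≤s; s≤s⁻¹; _≤ᵇ_; _≡ᵇ_; _≟_; _≤?_; _<?_)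
open import Data.Nat.Properties using (≤ᵇ⇒≤; ≡ᵇ⇒≡; ≡⇒≡ᵇ; ≤-refl; ≤-reflexive; ≤-trans; ≤∧≢⇒<; <⇒≱; m≤n⇒m≤1+n; m≤n⇒m⊓n≡m; suc-injective; +-suc; +-comm; +-assoc; +-identityʳ; +-mono-≤; *-monoˡ-≤; ∣-∣-comm; module ≤-Reasoning)
open import Data.Nat.Solver using (module +-*-Solver)
open import Data.Product using (_×_; _,_; Σ; ∃; proj₁; proj₂)
open import Data.Sum as Sum using (_⊎_; inj₁; inj₂; [_,_]′)
open import Data.Unit using (tt)
open import Data.Vec as Vec using (Vec; []; _∷_; zipWith; lookup)
open import Function using (_∘_; Equivalence)
open import Relation.Binary.PropositionalEquality
open import Relation.Binary.Structures using (IsTotalOrder)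
open import Relation.Nullary.Decidable using (Dec; yes; no; True; toWitness; from-yes; map′; _×-dec_; _⊎-dec_)

open Equivalence using (to; from)

private
  variable
    n : ℕ

-- Quadratic form over F₂ and its isometries.

parity : Vec Bool n → Bool
parity []       = false
parity (x ∷ xs) = x xor parity xs

dot : Vec Bool n → Vec Bool n → Bool
dot []       []       = false
dot (x ∷ xs) (y ∷ ys) = (x ∧ y) xor dot xs ys

-- The second elementary symmetric polynomial; form is its polarisation.
q : Vec Bool n → Bool
q []       = false
q (x ∷ xs) = (x ∧ parity xs) xor q xs

form : Vec Bool n → Vec Bool n → Bool
form x y = (parity x ∧ parity y) xor dot x y

infixl 6 _⊕_
_⊕_ : Vec Bool n → Vec Bool n → Vec Bool n
_⊕_ = zipWith _xor_

module _ where
  open xor-∧-Solver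

  parity-⊕ : (x y : Vec Bool n) → parity (x ⊕ y) ≡ parity x xor parity y
  parity-⊕ []       []       = refl
  parity-⊕ (x ∷ xs) (y ∷ ys) rewrite parity-⊕ xs ys =
    solve 4 (λ x y a b → (x :+ y) :+ (a :+ b) := (x :+ a) :+ (y :+ b)) refl x y (parity xs) (parity ys)

  dot-⊕ : (x y z : Vec Bool n) → dot (x ⊕ y) z ≡ dot x z xor dot y z
  dot-⊕ []       []       []       = refl
  dot-⊕ (x ∷ xs) (y ∷ ys) (z ∷ zs) rewrite dot-⊕ xs ys zs =
    solve 5 (λ x y z a b → (x :+ y) :* z :+ (a :+ b) := (x :* z :+ a) :+ (y :* z :+ b)) refl
      x y z (dot xs zs) (dot ys zs)

  dot-comm : (x y : Vec Bool n) → dot x y ≡ dot y x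
  dot-comm []       []       = refl
  dot-comm (x ∷ xs) (y ∷ ys) = cong₂ _xor_ (∧-comm x y) (dot-comm xs ys)

  dot-self : (x : Vec Bool n) → dot x x ≡ parity x
  dot-self []           = refl
  dot-self (false ∷ xs) = dot-self xs
  dot-self (true ∷ xs)  = cong not (dot-self xs)

  form-⊕ : (x y z : Vec Bool n) → form (x ⊕ y) z ≡ form x z xor form y z
  form-⊕ x y z rewrite parity-⊕ x y | dot-⊕ x y z =
    solve 5 (λ a b c d e → (a :+ b) :* c :+ (d :+ e) := (a :* c :+ d) :+ (b :* c :+ e)) refl
      (parity x) (parity y) (parity z) (dot x z) (dot y z)

  form-comm : (x y : Vec Bool n) → form x y ≡ form y x
  form-comm x y = cong₂ _xor_ (∧-comm (parity x) (parity y)) (dot-comm x y)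

  form-self : (x : Vec Bool n) → form x x ≡ false
  form-self x rewrite dot-self x with parity x
  ... | true  = refl
  ... | false = refl

  q-⊕ : (x y : Vec Bool n) → q (x ⊕ y) ≡ (q x xor q y) xor form x y
  q-⊕ []       []       = refl
  q-⊕ (x ∷ xs) (y ∷ ys) rewrite parity-⊕ xs ys | q-⊕ xs ys =
    solve 7 (λ x y a b c d e →
      (x :+ y) :* (a :+ b) :+ ((c :+ d) :+ (a :* b :+ e)) :=
      ((x :* a :+ c) :+ (y :* b :+ d)) :+ ((x :+ a) :* (y :+ b) :+ (x :* y :+ e))) refl
      x y (parity xs) (parity ys) (q xs) (q ys) (dot xs ys)

⊕-cancel : (x y : Vec Bool n) → x ⊕ (x ⊕ y) ≡ y
⊕-cancel []           []       = refl
⊕-cancel (false ∷ xs) (y ∷ ys) = cong (y ∷_) (⊕-cancel xs ys)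
⊕-cancel (true ∷ xs)  (true ∷ ys)  = cong (true ∷_) (⊕-cancel xs ys)
⊕-cancel (true ∷ xs)  (false ∷ ys) = cong (false ∷_) (⊕-cancel xs ys)

form-⊕-⊕ : (x y z w : Vec Bool n) →
  form (x ⊕ y) (z ⊕ w) ≡ (form x z xor form x w) xor (form y z xor form y w)
form-⊕-⊕ x y z w = begin
  form (x ⊕ y) (z ⊕ w)                                  ≡⟨ form-⊕ x y (z ⊕ w) ⟩
  form x (z ⊕ w) xor form y (z ⊕ w)                     ≡⟨ cong₂ _xor_ (split x) (split y) ⟩
  (form x z xor form x w) xor (form y z xor form y w)   ∎
  where
  open ≡-Reasoning
  split : ∀ v → form v (z ⊕ w) ≡ form v z xor form v w
  split v rewrite form-comm v (z ⊕ w) | form-comm v z | form-comm v w = form-⊕ z w v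

transvection : Vec Bool n → Vec Bool n → Vec Bool n
transvection a v = if form v a then v ⊕ a else v

form-transvection : (a v w : Vec Bool n) →
  form (transvection a v) (transvection a w) ≡ form v w
form-transvection a v w with form v a in va | form w a in wa
... | false | false = refl
... | true  | false rewrite form-⊕ v a w | form-comm a w | wa = xor-identityʳ _
... | false | true  rewrite form-comm v (w ⊕ a) | form-⊕ w a v | form-comm a v | va | form-comm w v = xor-identityʳ _
... | true  | true  rewrite form-⊕-⊕ v a w a | va | form-comm a w | wa | form-self a with form v w
...   | true  = refl
...   | false = refl

-- If `form v a` is 1, then `q (v ⊕ a)` is `q v` + `q a` + 1, and the two extra terms cancel exactly
-- because `q a` is 1.
q-transvection : (a v : Vec Bool n) → q a ≡ true → q (transvection a v) ≡ q v
q-transvection a v qa with form v a in va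
... | false = refl
... | true rewrite q-⊕ v a | qa | va with q v
...   | true  = refl
...   | false = refl

transvection-swaps : (u w : Vec Bool n) → form u w ≡ true → transvection (u ⊕ w) u ≡ w
transvection-swaps u w uw
  rewrite form-comm u (u ⊕ w) | form-⊕ u w u | form-self u | form-comm w u | uw = ⊕-cancel u w

record Isometry (n : ℕ) : Set where
  field
    apply    : Vec Bool n → Vec Bool n
    form-inv : ∀ v w → form (apply v) (apply w) ≡ form v w
    q-inv    : ∀ v → q (apply v) ≡ q v
open Isometry

-- `q (u ⊕ w)` is 1 + 1 + 1 = 1, so the transvection along `u ⊕ w` preserves `q`; as
-- `form u (u ⊕ w)` is 1, it moves u to u ⊕ (u ⊕ w) = w.
swapping : (u w : Vec Bool n) → q u ≡ true → q w ≡ true → form u w ≡ true →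
  Σ (Isometry n) λ g → apply g u ≡ w
swapping u w qu qw uw = g , transvection-swaps u w uw
  where
  q-sum : q (u ⊕ w) ≡ true
  q-sum rewrite q-⊕ u w | qu | qw | uw = refl
  g : Isometry _
  g .apply        = transvection (u ⊕ w)
  g .form-inv     = form-transvection (u ⊕ w)
  g .q-inv    v   = q-transvection (u ⊕ w) v q-sum

_∘ᵢ_ : Isometry n → Isometry n → Isometry n
(g ∘ᵢ h) .apply        = apply g ∘ apply h
(g ∘ᵢ h) .form-inv v w = trans (form-inv g _ _) (form-inv h v w)
(g ∘ᵢ h) .q-inv    v   = trans (q-inv g _) (q-inv h v)

-- Cliques, anticomplete pairs and exhaustive search.

vectors : ∀ n → List (Vec Bool n)
vectors zero    = [] ∷ []
vectors (suc n) = map (false ∷_) (vectors n) ++ map (true ∷_) (vectors n)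

∈-vectors : (v : Vec Bool n) → v ∈ vectors n
∈-vectors []          = here refl
∈-vectors (false ∷ v) = ∈-++⁺ˡ (∈-map⁺ _ (∈-vectors v))
∈-vectors (true ∷ v)  = ∈-++⁺ʳ _ (∈-map⁺ _ (∈-vectors v))

-- This is not unit-distance adjacency but nearly its opposite: orthogonal roots cannot share a
-- colour, so the roots of one colour class, taken up to sign, become a clique for `Adj`.
Adj Non : Vec Bool n → Vec Bool n → Set
Adj u v = T (form u v)
Non u v = T (not (form u v))

Clique : List (Vec Bool n) → Set
Clique = AllPairs Adj

Anticomplete : List (Vec Bool n) → List (Vec Bool n) → Set
Anticomplete F B = All (λ f → All (Non f) B) F

Adj-sym : (u v : Vec Bool n) → Adj u v → Adj v u
Adj-sym u v = subst T (form-comm u v)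

Non-sym : (u v : Vec Bool n) → Non u v → Non v u
Non-sym u v = subst (T ∘ not) (form-comm u v)

Anticomplete-sym : {F B : List (Vec Bool n)} → Anticomplete F B → Anticomplete B F
Anticomplete-sym = All.map (λ {b} → All.map (λ {f} → Non-sym f b)) ∘ All.All-swap

Adj-irrefl : (u : Vec Bool n) → Adj u u → ⊥
Adj-irrefl u = subst T (form-self u)

Adj-neighbours : {u v : Vec Bool n} {cs : List (Vec Bool n)} → u ∈ v ∷ cs → Adj v u → u ∈ cs
Adj-neighbours {u = u} (here refl) a = ⊥-elim (Adj-irrefl u a)
Adj-neighbours (there u∈)  _ = u∈

-- The branching step of both searches. No vector is adjacent to itself, so a clique through v
-- contains it once and the rest avoids v.
extract : {v : Vec Bool n} {cs : List (Vec Bool n)} (L : List (Vec Bool n)) →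
  Clique L → All (_∈ v ∷ cs) L →
  All (_∈ cs) L ⊎
  ∃ λ L′ → L ↭ v ∷ L′ × Clique L′ × All (Adj v) L′ × All (_∈ cs) L′
extract []      []        []                = inj₁ []
extract (u ∷ L) (uL ∷ cL) (here refl ∷ L∈)  =
  inj₂ (L , ↭-refl , cL , uL , All.zipWith (λ (p , a) → Adj-neighbours p a) (L∈ , uL))
extract (u ∷ L) (uL ∷ cL) (there u∈ ∷ L∈) with extract L cL L∈
... | inj₁ L∈′ = inj₁ (u∈ ∷ L∈′)
... | inj₂ (L′ , L↭ , cL′ , vL′ , L′∈) with All-resp-↭ L↭ uL
...   | uv ∷ uL′ = inj₂ ( u ∷ L′ , ↭-trans (prep u L↭) (swap u _ ↭-refl) , uL′ ∷ cL′
                       , Adj-sym u _ uv ∷ vL′ , u∈ ∷ L′∈ )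

-- Exhaustive search: no clique inside the list has more than k elements.
cliqueBound : ℕ → List (Vec Bool n) → Bool
cliqueBound k       []       = true
cliqueBound zero    (v ∷ cs) = false
cliqueBound (suc k) (v ∷ cs) =
  (length cs ≤ᵇ k) ∨ (cliqueBound k (filterᵇ (form v) cs) ∧ cliqueBound (suc k) cs)

-- Exhaustive search: a clique in cB that has no edge to some p-clique in cF has at most k elements.
pairBound : ℕ → ℕ → List (Vec Bool n) → List (Vec Bool n) → Bool
pairBound zero    k cF       cB = cliqueBound k cB
pairBound (suc p) k []       cB = true
pairBound (suc p) k (v ∷ cF) cB =
  pairBound p k (filterᵇ (form v) cF) (filterᵇ (not ∘ form v) cB) ∧ pairBound (suc p) k cF cB

∈-filterᵇ : {A : Set} (p : A → Bool) {xs L : List A} →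
  All (T ∘ p) L → All (_∈ xs) L → All (_∈ filterᵇ p xs) L
∈-filterᵇ p ps L∈ = All.zipWith (λ (t , x∈) → ∈-filter⁺ (T? ∘ p) x∈ t) (ps , L∈)

-- Cliques have no repeated vectors. This justifies the pruning test `length cs ≤ᵇ k` in
-- `cliqueBound`.
clique-length : (cs L : List (Vec Bool n)) → Clique L → All (_∈ cs) L → length L ≤ length cs
clique-length []       []      _  _        = z≤n
clique-length []       (_ ∷ _) _  (() ∷ _)
clique-length (v ∷ cs) L       cL L∈ with extract L cL L∈
... | inj₁ L∈′                        = m≤n⇒m≤1+n (clique-length cs L cL L∈′)
... | inj₂ (L′ , L↭ , cL′ , _ , L′∈) =
  ≤-trans (≤-reflexive (↭-length L↭)) (s≤s (clique-length cs L′ cL′ L′∈))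

∧-true : ∀ {x y} → x ∧ y ≡ true → x ≡ true × y ≡ true
∧-true {true} {true} _ = refl , refl

∨-true : ∀ {x y} → x ∨ y ≡ true → x ≡ true ⊎ y ≡ true
∨-true {true}  _ = inj₁ refl
∨-true {false} e = inj₂ e

cliqueBound-sound : ∀ k (cs L : List (Vec Bool n)) → cliqueBound k cs ≡ true →
  Clique L → All (_∈ cs) L → length L ≤ k
cliqueBound-sound k       []       L ok cL L∈ = ≤-trans (clique-length [] L cL L∈) z≤n
cliqueBound-sound (suc k) (v ∷ cs) L ok cL L∈ =
  [ (λ short → ≤-trans (clique-length (v ∷ cs) L cL L∈) (s≤s (≤ᵇ⇒≤ _ _ (from T-≡ short))))
  , (λ oks →
      [ cliqueBound-sound (suc k) cs L (proj₂ (∧-true oks)) cL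
      , (λ (L′ , L↭ , cL′ , vL′ , L′∈) → ≤-trans (≤-reflexive (↭-length L↭))
          (s≤s (cliqueBound-sound k _ L′ (proj₁ (∧-true oks)) cL′ (∈-filterᵇ (form v) vL′ L′∈))))
      ]′ (extract L cL L∈))
  ]′ (∨-true ok)

pairBound-sound : ∀ p k (cF cB F B : List (Vec Bool n)) → pairBound p k cF cB ≡ true →
  Clique F → All (_∈ cF) F → length F ≡ p → Clique B → All (_∈ cB) B →
  Anticomplete F B → length B ≤ k
pairBound-sound zero    k cF cB F B ok _ _ _ cliB B∈ _ = cliqueBound-sound k cB B ok cliB B∈
pairBound-sound (suc p) k [] cB (_ ∷ _) B ok _ (() ∷ _) _ _ _ _
pairBound-sound (suc p) k (v ∷ cF) cB F B ok cliF F∈ F≡ cliB B∈ FB =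
  [ (λ F∈′ → pairBound-sound (suc p) k cF cB F B (proj₂ (∧-true ok)) cliF F∈′ F≡ cliB B∈ FB)
  -- With v moved to the front of F, the head of `FB′` says that B survives the filter on `cB`.
  , (λ (F′ , F↭ , cliF′ , vF′ , F′∈) → let FB′ = All-resp-↭ F↭ FB in
      pairBound-sound p k _ _ F′ B (proj₁ (∧-true ok)) cliF′ (∈-filterᵇ (form v) vF′ F′∈)
        (suc-injective (trans (sym (↭-length F↭)) F≡)) cliB (∈-filterᵇ (not ∘ form v) (All.head FB′) B∈)
        (All.tail FB′))
  ]′ (extract F cliF F∈)

-- Reduction to a base vector and the bound 8 for anticomplete pairs.

-- Transvections act transitively on nonsingular vectors, so one vector of a clique may be
-- assumed to be e₀; this keeps the searches small.
e₀ : Vec Bool 8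
e₀ = true ∷ true ∷ false ∷ false ∷ false ∷ false ∷ false ∷ false ∷ []

nonsingular neighbours nonNeighbours : List (Vec Bool 8)
nonsingular   = filterᵇ q (vectors 8)
neighbours    = filterᵇ (form e₀) nonsingular
nonNeighbours = filterᵇ (not ∘ form e₀) nonsingular

Nonsingular : Vec Bool n → Set
Nonsingular v = T (q v)

linksToBase : Vec Bool 8 → Vec Bool 8 → Bool
linksToBase u v = q v ∧ (form u v ∧ form v e₀)

all-true : {A : Set} (p : A → Bool) (xs : List A) → all p xs ≡ true → All (λ x → p x ≡ true) xs
all-true p []       _ = []
all-true p (x ∷ xs) e = proj₁ (∧-true e) ∷ all-true p xs (proj₂ (∧-true e))

-- Not every u has form 1 with `e₀`, so one swap need not be enough; a common neighbour v always
-- allows two, from u to v to `e₀`. Checked by evaluation on all 120 nonsingular vectors.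
linked : all (λ u → any (linksToBase u) (vectors 8)) nonsingular ≡ true
linked = refl

∈-nonsingular : {L : List (Vec Bool 8)} → All Nonsingular L → All (_∈ nonsingular) L
∈-nonsingular qL = ∈-filterᵇ q qL (All.universal ∈-vectors _)

link : (u : Vec Bool 8) → Nonsingular u →
  ∃ λ v → q v ≡ true × form u v ≡ true × form v e₀ ≡ true
link u qu = v , proj₁ t′ , ∧-true (proj₂ t′)
  where
  found : any (linksToBase u) (vectors 8) ≡ true
  found = All.lookup (all-true (λ u → any (linksToBase u) (vectors 8)) nonsingular linked) (∈-filter⁺ (T? ∘ q) (∈-vectors u) qu)
  witness : ∃ λ v → T (linksToBase u v)
  witness = satisfied (Any.any⁻ (linksToBase u) (vectors 8) (from T-≡ found))
  v : Vec Bool 8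
  v = proj₁ witness
  t′ : q v ≡ true × (form u v ∧ form v e₀) ≡ true
  t′ = ∧-true (to T-≡ (proj₂ witness))

toBase : (u : Vec Bool 8) → Nonsingular u → Σ (Isometry 8) λ g → apply g u ≡ e₀
toBase u qu =
  let v , qv , uv , ve = link u qu
      g , gu = swapping u v (to T-≡ qu) qv uv
      h , hv = swapping v e₀ qv refl ve
  in h ∘ᵢ g , trans (cong (apply h) gu) hv

module _ (g : Isometry n) where

  private
    ĝ : List (Vec Bool n) → List (Vec Bool n)
    ĝ = map (apply g)

  map-Adj : (u : Vec Bool n) {v : Vec Bool n} {L : List (Vec Bool n)} → apply g u ≡ v → All (Adj u) L → All (Adj v) (ĝ L)
  map-Adj u refl = All.map⁺ ∘ All.map (subst T (sym (form-inv g _ _)))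

  map-Non : (u : Vec Bool n) {v : Vec Bool n} {L : List (Vec Bool n)} → apply g u ≡ v → All (Non u) L → All (Non v) (ĝ L)
  map-Non u refl = All.map⁺ ∘ All.map (subst (T ∘ not) (sym (form-inv g _ _)))

  map-Clique : {L : List (Vec Bool n)} → Clique L → Clique (ĝ L)
  map-Clique = AllPairs.map⁺ ∘ AllPairs.map (subst T (sym (form-inv g _ _)))

  map-Nonsingular : {L : List (Vec Bool n)} → All Nonsingular L → All Nonsingular (ĝ L)
  map-Nonsingular = All.map⁺ ∘ All.map (subst T (sym (q-inv g _)))

  map-Anticomplete : {F B : List (Vec Bool n)} → Anticomplete F B → Anticomplete (ĝ F) (ĝ B)
  map-Anticomplete =
    All.map⁺ ∘ All.map (All.map⁺ ∘ All.map (subst (T ∘ not) (sym (form-inv g _ _))))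

cliqueBound-7 : cliqueBound 7 neighbours ≡ true
cliqueBound-7 = refl

-- Since `e₀` itself is not counted in p, the values p = 0, 1, 3 describe cliques of size 1, 2, 4; a
-- clique anticomplete to one of them has size at most 7, 5, 4.
pairBound-0-7 : pairBound 0 7 neighbours nonNeighbours ≡ true
pairBound-0-7 = refl

pairBound-1-5 : pairBound 1 5 neighbours nonNeighbours ≡ true
pairBound-1-5 = refl

pairBound-3-4 : pairBound 3 4 neighbours nonNeighbours ≡ true
pairBound-3-4 = refl

rooted-clique : ∀ f F → All Nonsingular (f ∷ F) → Clique (f ∷ F) → length F ≤ 7
rooted-clique f F (qf ∷ qF) (fF ∷ cF) = let g , gf = toBase f qf in subst (_≤ 7) (length-map (apply g) F)
  (cliqueBound-sound 7 neighbours (map (apply g) F) cliqueBound-7 (map-Clique g cF)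
    (∈-filterᵇ (form e₀) (map-Adj g f gf fF) (∈-nonsingular (map-Nonsingular g qF))))

-- The isometry taking f to `e₀` carries the rest of F among the neighbours of `e₀` and B among its
-- non-neighbours, which are the lists searched.
rooted-pair : ∀ p k → pairBound p k neighbours nonNeighbours ≡ true →
  ∀ f F B → All Nonsingular (f ∷ F) → All Nonsingular B → Clique (f ∷ F) → Clique B →
  Anticomplete (f ∷ F) B → length F ≡ p → length B ≤ k
rooted-pair p k ok f F B (qf ∷ qF) qB (fF ∷ cF) cB (fB ∷ FB) F≡p = let g , gf = toBase f qf in subst (_≤ k) (length-map (apply g) B)
  (pairBound-sound p k neighbours nonNeighbours (map (apply g) F) (map (apply g) B) ok
    (map-Clique g cF) (∈-filterᵇ (form e₀) (map-Adj g f gf fF) (∈-nonsingular (map-Nonsingular g qF)))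
    (trans (length-map (apply g) F) F≡p)
    (map-Clique g cB) (∈-filterᵇ (not ∘ form e₀) (map-Non g f gf fB) (∈-nonsingular (map-Nonsingular g qB)))
    (map-Anticomplete g FB))

-- Being anticomplete passes to subsets, so F may be cut down to its first p + 1 vectors.
pair-bound : ∀ p k → pairBound p k neighbours nonNeighbours ≡ true →
  (F B : List (Vec Bool 8)) → All Nonsingular F → All Nonsingular B → Clique F → Clique B →
  Anticomplete F B → p < length F → length B ≤ k
pair-bound p k ok (f ∷ F) B (qf ∷ qF) qB (fF ∷ cF) cB (fB ∷ FB) (s≤s p≤) =
  rooted-pair p k ok f (take p F) B (qf ∷ All.take⁺ p qF) qB
    (All.take⁺ p fF ∷ AllPairs.take⁺ p cF) cB (fB ∷ All.take⁺ p FB)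
    (trans (length-take p F) (m≤n⇒m⊓n≡m p≤))

clique-bound : (F : List (Vec Bool 8)) → All Nonsingular F → Clique F → length F ≤ 8
clique-bound []      _  _  = z≤n
clique-bound (f ∷ F) qF cF = s≤s (rooted-clique f F qF cF)

-- Size 3 inherits the bound 5 from size 2, which still gives 3 + 5 = 8; when both sizes are at
-- least 4, both are at most 4.
sum≤8 : ∀ x y → x ≤ 8 → y ≤ 8 →
  (0 < x → y ≤ 7) → (1 < x → y ≤ 5) → (3 < x → y ≤ 4) →
  (0 < y → x ≤ 7) → (1 < y → x ≤ 5) → (3 < y → x ≤ 4) → x + y ≤ 8
sum≤8 0 y x≤ y≤ a b c d e f = y≤
sum≤8 1 y x≤ y≤ a b c d e f = s≤s (a (s≤s z≤n))
sum≤8 2 y x≤ y≤ a b c d e f = m≤n⇒m≤1+n (s≤s (s≤s (b (s≤s (s≤s z≤n)))))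
sum≤8 3 y x≤ y≤ a b c d e f = s≤s (s≤s (s≤s (b (s≤s (s≤s z≤n)))))
sum≤8 x@(suc (suc (suc (suc _)))) 0 x≤ y≤ a b c d e f = +-mono-≤ x≤ (z≤n {0})
sum≤8 x@(suc (suc (suc (suc _)))) 1 x≤ y≤ a b c d e f = +-mono-≤ (d (s≤s z≤n)) (≤-refl {1})
sum≤8 x@(suc (suc (suc (suc _)))) 2 x≤ y≤ a b c d e f =
  +-mono-≤ (m≤n⇒m≤1+n (e (s≤s (s≤s z≤n)))) (≤-refl {2})
sum≤8 x@(suc (suc (suc (suc _)))) 3 x≤ y≤ a b c d e f = +-mono-≤ (e (s≤s (s≤s z≤n))) (≤-refl {3})
sum≤8 x@(suc (suc (suc (suc _)))) y@(suc (suc (suc (suc _)))) x≤ y≤ a b c d e f =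
  +-mono-≤ (f (s≤s (s≤s (s≤s (s≤s z≤n))))) (c (s≤s (s≤s (s≤s (s≤s z≤n)))))

clique-pair-bound : (F B : List (Vec Bool 8)) → All Nonsingular F → All Nonsingular B → Clique F → Clique B →
  Anticomplete F B → length F + length B ≤ 8
clique-pair-bound F B qF qB cF cB FB =
  sum≤8 (length F) (length B) (clique-bound F qF cF) (clique-bound B qB cB)
    (pair-bound 0 7 pairBound-0-7 F B qF qB cF cB FB)
    (pair-bound 1 5 pairBound-1-5 F B qF qB cF cB FB)
    (pair-bound 3 4 pairBound-3-4 F B qF qB cF cB FB)
    (pair-bound 0 7 pairBound-0-7 B F qB qF cB cF BF)
    (pair-bound 1 5 pairBound-1-5 B F qB qF cB cF BF)
    (pair-bound 3 4 pairBound-3-4 B F qB qF cB cF BF)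
  where
  BF : Anticomplete B F
  BF = Anticomplete-sym FB

-- Counting and the pigeonhole principle.

count : {A : Set} → (A → Bool) → List A → ℕ
count p xs = length (filterᵇ p xs)

module _ {A : Set} where

  count-++ : (p : A → Bool) (xs ys : List A) → count p (xs ++ ys) ≡ count p xs + count p ys
  count-++ p []       ys = refl
  count-++ p (x ∷ xs) ys with p x
  ... | true  = cong suc (count-++ p xs ys)
  ... | false = count-++ p xs ys

  count-map : {B : Set} (p : A → Bool) (f : B → A) (xs : List B) → count p (map f xs) ≡ count (p ∘ f) xs
  count-map p f []       = refl
  count-map p f (x ∷ xs) with p (f x)
  ... | true  = cong suc (count-map p f xs)
  ... | false = count-map p f xs

  -- Inclusion-exclusion. With f and g as the two signs, it counts the points of a class as roots up
  -- to sign plus roots with both signs.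
  count-∨-∧ : (f g : A → Bool) (xs : List A) →
    count f xs + count g xs ≡ count (λ x → f x ∨ g x) xs + count (λ x → f x ∧ g x) xs
  count-∨-∧ f g []       = refl
  count-∨-∧ f g (x ∷ xs) with f x | g x
  ... | false | false = count-∨-∧ f g xs
  ... | true  | false = cong suc (count-∨-∧ f g xs)
  ... | false | true  = trans (+-suc _ _) (cong suc (count-∨-∧ f g xs))
  ... | true  | true  = cong suc (trans (+-suc _ _) (trans (cong suc (count-∨-∧ f g xs)) (sym (+-suc _ _))))

  length-split : (p : A → Bool) (xs : List A) → length xs ≡ count p xs + count (not ∘ p) xs
  length-split p []       = refl
  length-split p (x ∷ xs) with p x
  ... | true  = cong suc (length-split p xs)
  ... | false = trans (cong suc (length-split p xs)) (sym (+-suc _ _))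

  count-filter : (p r : A → Bool) (xs : List A) → count p (filterᵇ r xs) ≤ count p xs
  count-filter p r []       = z≤n
  count-filter p r (x ∷ xs) with r x
  count-filter p r (x ∷ xs) | true with p x
  ... | true  = s≤s (count-filter p r xs)
  ... | false = count-filter p r xs
  count-filter p r (x ∷ xs) | false with p x
  ... | true  = m≤n⇒m≤1+n (count-filter p r xs)
  ... | false = count-filter p r xs

-- Induction on the number of colours: the top colour accounts for at most k entries, and filtering
-- it out leaves smaller colours only.
pigeonhole : ∀ m k (cs : List ℕ) → All (_< m) cs → (∀ c → count (c ≡ᵇ_) cs ≤ k) → length cs ≤ m * k
pigeonhole zero    k []       _        _ = z≤n
pigeonhole zero    k (_ ∷ _)  (() ∷ _) _
pigeonhole (suc m) k cs cs< small = begin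
  length cs                                  ≡⟨ length-split (m ≡ᵇ_) cs ⟩
  count (m ≡ᵇ_) cs + length rest             ≤⟨ +-mono-≤ (small m) (pigeonhole m k rest rest<
                                                  λ c → ≤-trans (count-filter (c ≡ᵇ_) _ cs) (small c)) ⟩
  k + m * k                                  ∎
  where
  open ≤-Reasoning
  rest : List ℕ
  rest = filterᵇ (not ∘ (m ≡ᵇ_)) cs
  differs : ∀ c → T (not (m ≡ᵇ c)) → c ≢ m
  differs c t refl with m ≡ᵇ m | ≡⇒≡ᵇ m m refl
  ... | true | _ = t
  rest< : All (_< m) rest
  rest< = All.zipWith (λ {c} (t , c<) → ≤∧≢⇒< (s≤s⁻¹ c<) (differs c t))
    (All.all-filter (T? ∘ not ∘ (m ≡ᵇ_)) cs , All.filter⁺ (T? ∘ not ∘ (m ≡ᵇ_)) cs<)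

-- Colour classes of signed roots.

All-pairs-with : {A : Set} {P : A → Set} {R S : A → A → Set} {xs : List A} →
  (∀ {x y} → R x y → P x → P y → S x y) → AllPairs R xs → All P xs → AllPairs S xs
All-pairs-with f []         []         = []
All-pairs-with f (xR ∷ Rxs) (px ∷ pxs) =
  All.zipWith (λ (r , py) → f r px py) (xR , pxs) ∷ All-pairs-with f Rxs pxs

module _ {A : Set} where

  -- `Q s x` is read as: the point given by the root x with sign s lies in the colour class.
  some both : (Bool → A → Bool) → A → Bool
  some Q x = Q true x ∨ Q false x
  both Q x = Q true x ∧ Q false x

  some-sign : (Q : Bool → A → Bool) {x : A} → T (some Q x) → ∃ λ s → T (Q s x)
  some-sign Q {x} t with to (T-∨ {Q true x}) t
  ... | inj₁ t′ = true  , t′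
  ... | inj₂ t′ = false , t′

  both-signs : (Q : Bool → A → Bool) {x : A} → T (both Q x) → ∀ s → T (Q s x)
  both-signs Q {x} t true  = proj₁ (to (T-∧ {Q true x}) t)
  both-signs Q {x} t false = proj₂ (to (T-∧ {Q true x}) t)

  total : (Bool → A → Bool) → List A → ℕ
  total Q xs = count (Q true) xs + count (Q false) xs

  Conflict : (Bool → A → Bool) → (Bool → A → Bool) → Bool → A → Bool → A → Set
  Conflict Q Q′ s x t y = T (Q s x) → T (Q′ t y) → ⊥

  module _ (φ : A → Vec Bool 8) where

    some-vectors both-vectors : (Bool → A → Bool) → List A → List (Vec Bool 8)
    some-vectors Q R = map φ (filterᵇ (some Q) R)
    both-vectors Q R = map φ (filterᵇ (both Q) R)

    OddOrConflict : (Bool → A → Bool) → A → A → Set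
    OddOrConflict Q x y = Adj (φ x) (φ y) ⊎ (∀ s t → Conflict Q Q s x t y)

    -- The sign s may depend on t: between two copies only one of x and -x is at unit distance from
    -- a given odd partner, which is enough when x occurs with both signs.
    EvenOrConflict : (Bool → A → Bool) → (Bool → A → Bool) → A → A → Set
    EvenOrConflict Q Q′ x y = Non (φ x) (φ y) ⊎ (∀ t → ∃ λ s → Conflict Q Q′ s x t y)

    some-Clique : ∀ Q {R} → AllPairs (OddOrConflict Q) R → Clique (some-vectors Q R)
    some-Clique Q {R} odd = AllPairs.map⁺ (All-pairs-with adj
        (AllPairs.filter⁺ (T? ∘ some Q) odd) (All.all-filter (T? ∘ some Q) R))
      where
      adj : ∀ {x y} → OddOrConflict Q x y → T (some Q x) → T (some Q y) → Adj (φ x) (φ y)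
      adj (inj₁ a) _  _  = a
      adj (inj₂ c) tx ty = let s , Qx = some-sign Q tx ; t , Qy = some-sign Q ty in ⊥-elim (c s t Qx Qy)

    both-Clique : ∀ Q {R} → AllPairs (OddOrConflict Q) R → Clique (both-vectors Q R)
    both-Clique Q {R} odd = AllPairs.map⁺ (All-pairs-with adj
        (AllPairs.filter⁺ (T? ∘ both Q) odd) (All.all-filter (T? ∘ both Q) R))
      where
      adj : ∀ {x y} → OddOrConflict Q x y → T (both Q x) → T (both Q y) → Adj (φ x) (φ y)
      adj (inj₁ a) _  _  = a
      adj (inj₂ c) tx ty = ⊥-elim (c true true (both-signs Q tx true) (both-signs Q ty true))

    both-some-Anticomplete : ∀ Q Q′ {R} → All (λ x → All (EvenOrConflict Q Q′ x) R) R →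
      Anticomplete (both-vectors Q R) (some-vectors Q′ R)
    both-some-Anticomplete Q Q′ {R} even = All.map⁺ (All.zipWith
        (λ (tx , e) → All.map⁺ (All.zipWith (λ (ty , e′) → non e′ tx ty)
          (All.all-filter (T? ∘ some Q′) R , All.filter⁺ (T? ∘ some Q′) e)))
        (All.all-filter (T? ∘ both Q) R , All.filter⁺ (T? ∘ both Q) even))
      where
      non : ∀ {x y} → EvenOrConflict Q Q′ x y → T (both Q x) → T (some Q′ y) → Non (φ x) (φ y)
      non (inj₁ a) _  _  = a
      non (inj₂ c) tx ty = let t , Qy = some-sign Q′ ty ; s , clash = c t in ⊥-elim (clash (both-signs Q tx s) Qy)

    cross-bound : ∀ Q Q′ {R} → All (Nonsingular ∘ φ) R →
      AllPairs (OddOrConflict Q) R → AllPairs (OddOrConflict Q′) R →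
      All (λ x → All (EvenOrConflict Q Q′ x) R) R →
      count (both Q) R + count (some Q′) R ≤ 8
    cross-bound Q Q′ {R} ns odd odd′ even = subst (_≤ 8)
      (cong₂ _+_ (length-map φ (filterᵇ (both Q) R)) (length-map φ (filterᵇ (some Q′) R)))
      (clique-pair-bound (both-vectors Q R) (some-vectors Q′ R)
        (All.map⁺ (All.filter⁺ (T? ∘ both Q) ns)) (All.map⁺ (All.filter⁺ (T? ∘ some Q′) ns))
        (both-Clique Q odd) (some-Clique Q′ odd′) (both-some-Anticomplete Q Q′ even))

    two-layer-bound : ∀ Q Q′ {R} → All (Nonsingular ∘ φ) R →
      AllPairs (OddOrConflict Q) R → AllPairs (OddOrConflict Q′) R →
      All (λ x → All (EvenOrConflict Q Q′ x) R) R → All (λ x → All (EvenOrConflict Q′ Q x) R) R →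
      total Q R + total Q′ R ≤ 16
    two-layer-bound Q Q′ {R} ns odd odd′ even even′ = begin
      total Q R + total Q′ R  ≡⟨ cong₂ _+_ (count-∨-∧ (Q true) (Q false) R) (count-∨-∧ (Q′ true) (Q′ false) R) ⟩
      (x + p) + (y + r)       ≡⟨ cong (_+ (y + r)) (+-comm x p) ⟩
      (p + x) + (y + r)       ≡⟨ +-assoc p x (y + r) ⟩
      p + (x + (y + r))       ≡⟨ cong (p +_) (+-comm x (y + r)) ⟩
      p + ((y + r) + x)       ≡⟨ cong (p +_) (+-assoc y r x) ⟩
      p + (y + (r + x))       ≡⟨ +-assoc p y (r + x) ⟨
      (p + y) + (r + x)       ≤⟨ +-mono-≤ (cross-bound Q Q′ ns odd odd′ even) (cross-bound Q′ Q ns odd′ odd even′) ⟩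
      16                      ∎
      where
      open ≤-Reasoning
      x p y r : ℕ
      x = count (some Q) R
      p = count (both Q) R
      y = count (some Q′) R
      r = count (both Q′) R

-- The roots of E₈ and their reduction modulo 2.

-- Coordinates of E₈ are doubled and then shifted by 2 so as to be natural numbers: the
-- lattice origin is (2,…,2), negation is x ↦ 4 ∸ x, and norm 4 becomes squared distance 16.
dist² : Vec ℕ n → Vec ℕ n → ℕ
dist² []       []       = 0
dist² (x ∷ xs) (y ∷ ys) = ∣ x - y ∣ * ∣ x - y ∣ + dist² xs ys

dist²-comm : (v w : Vec ℕ n) → dist² v w ≡ dist² w v
dist²-comm []       []       = refl
dist²-comm (x ∷ xs) (y ∷ ys) rewrite ∣-∣-comm x y | dist²-comm xs ys = refl

origin : ∀ n → Vec ℕ n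
origin n = Vec.replicate n 2

signed : Bool → Vec ℕ n → Vec ℕ n
signed true  v = v
signed false v = Vec.map (4 ∸_) v

-- The vectors ±eᵢ, and the vectors eᵢ ± eⱼ with i < j.
axes pairs : ∀ n → List (Vec ℕ n)
axes zero     = []
axes (suc n)  = (4 ∷ origin n) ∷ (0 ∷ origin n) ∷ map (2 ∷_) (axes n)
pairs zero    = []
pairs (suc n) = map (4 ∷_) (axes n) ++ map (2 ∷_) (pairs n)

-- Vectors with all coordinates ±½; the Boolean is the parity of the number of minus signs.
halves : Bool → ∀ n → List (Vec ℕ n)
halves true  zero    = []
halves false zero    = [] ∷ []
halves b     (suc n) = map (3 ∷_) (halves b n) ++ map (1 ∷_) (halves (not b) n)

-- One root from each pair ±v.
roots : List (Vec ℕ 8)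
roots = pairs 8 ++ map (3 ∷_) (halves false 7)

odd : ℕ → Bool
odd n = n % 2 ≡ᵇ 1

-- Parities of the inner products with ½(1,…,1) and e₁ + eⱼ.  The Gram matrix of these eight
-- vectors is J − I modulo 2, its own inverse, which turns the lattice form into form.
mod2 : Vec ℕ (suc n) → Vec Bool (suc n)
mod2 (w ∷ ws) = odd ((w + Vec.sum ws) / 4) ∷ Vec.map (λ x → odd ((w + x) / 2)) ws

∀Bool? : {P : Bool → Set} → (∀ b → Dec (P b)) → Dec (∀ b → P b)
∀Bool? d = map′ (λ { (t , f) true → t ; (t , f) false → f }) (λ f → f true , f false) (d true ×-dec d false)

∃Bool? : {P : Bool → Set} → (∀ b → Dec (P b)) → Dec (∃ P)
∃Bool? d = map′ [ (true ,_) , (false ,_) ]′ (λ { (true , t) → inj₁ t ; (false , f) → inj₂ f })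
  (d true ⊎-dec d false)

OddOrFar : (p : Bool → Vec ℕ 8 → Vec ℕ 8) → Vec ℕ 8 → Vec ℕ 8 → Set
OddOrFar p v w = Adj (mod2 v) (mod2 w) ⊎ (∀ s t → dist² (p s v) (p t w) ≡ 16)

-- Here d is 8 when the offset between the layers adds another 8 outside these coordinates, and 16
-- when both copies lie in E₈ itself.
EvenOrAt : ℕ → (p p′ : Bool → Vec ℕ 8 → Vec ℕ 8) → Vec ℕ 8 → Vec ℕ 8 → Set
EvenOrAt d p p′ v w = Non (mod2 v) (mod2 w) ⊎ (∀ t → ∃ λ s → dist² (p s v) (p′ t w) ≡ d)

oddOrFar? : ∀ p v w → Dec (OddOrFar p v w)
oddOrFar? p v w = T? (form (mod2 v) (mod2 w)) ⊎-dec ∀Bool? λ s → ∀Bool? λ t → dist² (p s v) (p t w) ≟ 16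

evenOrAt? : ∀ d p p′ v w → Dec (EvenOrAt d p p′ v w)
evenOrAt? d p p′ v w =
  T? (not (form (mod2 v) (mod2 w))) ⊎-dec ∀Bool? λ t → ∃Bool? λ s → dist² (p s v) (p′ t w) ≟ d

roots-nonsingular : All (Nonsingular ∘ mod2) roots
roots-nonsingular = from-yes (all? (λ v → T? (q (mod2 v))) roots)

roots-norm : All (λ v → ∀ s → dist² (origin 8) (signed s v) ≡ 8) roots
roots-norm = from-yes (all? (λ v → ∀Bool? λ s → dist² (origin 8) (signed s v) ≟ 8) roots)

-- Roots that differ up to sign have inner product 0 or ±1, and orthogonal ones stay at squared
-- distance 2 + 2 = 4, scaled to 16, under all sign changes.
roots-odd : AllPairs (OddOrFar signed) roots
roots-odd = from-yes (allPairs? (oddOrFar? signed) roots)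

-- An odd inner product is ±1; the sign making it 1 gives a difference of norm 2, scaled to 8.
roots-even : All (λ v → All (EvenOrAt 8 signed signed v) roots) roots
roots-even = from-yes (all? (λ v → all? (evenOrAt? 8 signed signed v) roots) roots)

-- The E₇ roots, their translates and the spinors inside E₈.

-- With ρ = e₁ + e₂, headSum is 4 on vectors orthogonal to ρ and 6 on those with inner
-- product 1; raised is translation by ρ.
headSum : Vec ℕ 8 → ℕ
headSum (x ∷ y ∷ _) = x + y

roots₇ spinors : List (Vec ℕ 8)
roots₇  = filterᵇ (λ v → headSum v ≡ᵇ 4) roots
spinors = filterᵇ (λ v → headSum v ≡ᵇ 6) (roots ++ map (signed false) roots)

raised : Bool → Vec ℕ 8 → Vec ℕ 8
raised s v with signed s v
... | x ∷ y ∷ w = (2 + x) ∷ (2 + y) ∷ w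

roots₇-nonsingular : All (Nonsingular ∘ mod2) roots₇
roots₇-nonsingular = All.filter⁺ (λ v → T? (headSum v ≡ᵇ 4)) roots-nonsingular

roots₇-odd : AllPairs (OddOrFar signed) roots₇
roots₇-odd = AllPairs.filter⁺ (λ v → T? (headSum v ≡ᵇ 4)) roots-odd

roots₇-odd-raised : AllPairs (OddOrFar raised) roots₇
roots₇-odd-raised = from-yes (allPairs? (oddOrFar? raised) roots₇)

-- As ρ has norm 2 and is orthogonal to these roots, translating by it adds 8 to the scaled squared
-- distance, so inner product 1 now means 8 + 8 = 16.
roots₇-even : All (λ v → All (EvenOrAt 16 signed raised v) roots₇) roots₇
roots₇-even = from-yes (all? (λ v → all? (evenOrAt? 16 signed raised v) roots₇) roots₇)

roots₇-even-raised : All (λ v → All (EvenOrAt 16 raised signed v) roots₇) roots₇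
roots₇-even-raised = from-yes (all? (λ v → all? (evenOrAt? 16 raised signed v) roots₇) roots₇)

spinors-nonsingular : All (Nonsingular ∘ mod2) spinors
spinors-nonsingular = from-yes (all? (λ v → T? (q (mod2 v))) spinors)

spinors-odd : AllPairs (λ c d → Adj (mod2 c) (mod2 d) ⊎ dist² c d ≡ 16) spinors
spinors-odd = from-yes (allPairs? (λ c d → T? (form (mod2 c) (mod2 d)) ⊎-dec (dist² c d ≟ 16)) spinors)

-- For a spinor c, both c and c - ρ are roots with the same inner products with E₇ roots. Hence an
-- E₇ root orthogonal to c is at scaled squared distance 16 from c in either copy and with either
-- sign.
OddToSpinors : (p : Bool → Vec ℕ 8 → Vec ℕ 8) → Set
OddToSpinors p =
  All (λ v → All (λ c → Adj (mod2 v) (mod2 c) ⊎ (∀ s → dist² (p s v) c ≡ 16)) spinors) roots₇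

oddToSpinors? : ∀ p → Dec (OddToSpinors p)
oddToSpinors? p = all? (λ v → all? (λ c →
  T? (form (mod2 v) (mod2 c)) ⊎-dec ∀Bool? λ s → dist² (p s v) c ≟ 16) spinors) roots₇

roots₇-spinors : OddToSpinors signed
roots₇-spinors = from-yes (oddToSpinors? signed)

roots₇-spinors-raised : OddToSpinors raised
roots₇-spinors-raised = from-yes (oddToSpinors? raised)

-- For b fixed in B, the sums b ⊕ u with u ∈ B form a clique that has no edges to X ++ C.
third-line-bound : ∀ B X C → All Nonsingular B → All Nonsingular X → All Nonsingular C →
  Clique B → Clique X → Clique C → All (λ x → All (Adj x) C) X →
  Anticomplete B X → All (λ b → All (Adj b) C) B → length B + (length X + length C) ≤ 9
third-line-bound []      X C _ qX qC _ cX cC XC _ _ = m≤n⇒m≤1+n (subst (_≤ 8) (length-++ X)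
  (clique-pair-bound [] (X ++ C) [] (All.++⁺ qX qC) [] (AllPairs.++⁺ cX cC XC) []))
third-line-bound (b ∷ B) X C (qb ∷ qB) qX qC (bB ∷ cB) cX cC XC (bX ∷ BX) (bC ∷ BC) = s≤s (subst (_≤ 8)
  (cong₂ _+_ (length-map (b ⊕_) B) (length-++ X))
  (clique-pair-bound (map (b ⊕_) B) (X ++ C)
    (All.map⁺ (All.zipWith (λ {u} (bu , qu) → sum-nonsingular u bu qu) (bB , qB))) (All.++⁺ qX qC)
    (AllPairs.map⁺ (All-pairs-with (λ {u} {v} → sum-Adj u v) cB bB)) (AllPairs.++⁺ cX cC XC)
    (All.map⁺ (All.zipWith (λ {u} (uX , uC) → All.++⁺
      (All.zipWith (λ {x} (bx , ux) → sum-Non-Non u x bx ux) (bX , uX))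
      (All.zipWith (λ {c} (bc , uc) → sum-Adj-Adj u c bc uc) (bC , uC))) (BX , BC)))))
  where
  sum-nonsingular : ∀ u → Adj b u → Nonsingular u → Nonsingular (b ⊕ u)
  sum-nonsingular u bu qu rewrite q-⊕ b u | to T-≡ bu | to T-≡ qu | to T-≡ qb = tt

  sum-Adj : ∀ u v → Adj u v → Adj b u → Adj b v → Adj (b ⊕ u) (b ⊕ v)
  sum-Adj u v uv bu bv rewrite form-⊕-⊕ b u b v | form-self b | form-comm u b
    | to T-≡ uv | to T-≡ bu | to T-≡ bv = tt

  sum-Non-Non : ∀ u x → Non b x → Non u x → Non (b ⊕ u) x
  sum-Non-Non u x bx ux rewrite form-⊕ b u x | to T-not-≡ bx | to T-not-≡ ux = tt

  sum-Adj-Adj : ∀ u c → Adj b c → Adj u c → Non (b ⊕ u) c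
  sum-Adj-Adj u c bc uc rewrite form-⊕ b u c | to T-≡ bc | to T-≡ uc = tt

-- From colourings to bounds on class sizes.

same-class : ∀ c {a b} → T (c ≡ᵇ a) → T (c ≡ᵇ b) → a ≡ b
same-class c {a} {b} p r = trans (sym (≡ᵇ⇒≡ c a p)) (≡ᵇ⇒≡ c b r)

count-signed : {A : Set} (p : ℕ → Bool) (f : Bool → A → ℕ) (xs : List A) →
  count p (map (f true) xs ++ map (f false) xs) ≡ total (λ s → p ∘ f s) xs
count-signed p f xs = trans (count-++ p (map (f true) xs) (map (f false) xs))
  (cong₂ _+_ (count-map p (f true) xs) (count-map p (f false) xs))

EvenOrAt⇒EvenOrConflict : ∀ {d} p p′ Q Q′ {v w} →
  (∀ s t → dist² (p s v) (p′ t w) ≡ d → Conflict Q Q′ s v t w) →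
  EvenOrAt d p p′ v w → EvenOrConflict mod2 Q Q′ v w
EvenOrAt⇒EvenOrConflict p p′ Q Q′ conflict (inj₁ even) = inj₁ even
EvenOrAt⇒EvenOrConflict p p′ Q Q′ conflict (inj₂ near) =
  inj₂ λ t → let s , d = near t in s , conflict s t d

count-none : {A : Set} (p : A → Bool) {xs : List A} → All (T ∘ not ∘ p) xs → count p xs ≡ 0
count-none p []                = refl
count-none p {x ∷ xs} (t ∷ ts) with p x
... | false = count-none p ts

≢⇒not≡ᵇ : ∀ {a b} → a ≢ b → T (not (a ≡ᵇ b))
≢⇒not≡ᵇ {a} {b} a≢b with a ≡ᵇ b in eq
... | false = _
... | true  = a≢b (≡ᵇ⇒≡ a b (subst T (sym eq) _))

-- Repeating the apex k times lets it fill the colour class that no other vertex can use.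
cone-class-size : ∀ k a {cs : List ℕ} → All (a ≢_) cs → (∀ c → count (c ≡ᵇ_) cs ≤ k) →
  ∀ c → count (c ≡ᵇ_) (replicate k a ++ cs) ≤ k
cone-class-size k a {cs} apart small c
  rewrite count-++ (c ≡ᵇ_) (replicate k a) cs with c ≟ a
... | yes refl rewrite count-none (a ≡ᵇ_) (All.map ≢⇒not≡ᵇ apart) =
  ≤-trans (≤-reflexive (+-identityʳ _))
    (≤-trans (length-filter (T? ∘ (a ≡ᵇ_)) (replicate k a)) (≤-reflexive (length-replicate k)))
... | no c≢a rewrite count-none (c ≡ᵇ_) (All.replicate⁺ k (≢⇒not≡ᵇ c≢a)) = small c

All-signed : {A : Set} (P : ℕ → Set) (f : Bool → A → ℕ) (xs : List A) →
  All (λ x → ∀ s → P (f s x)) xs → All P (map (f true) xs ++ map (f false) xs)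
All-signed P f xs ps =
  All.++⁺ (All.map⁺ (All.map (λ p → p true) ps)) (All.map⁺ (All.map (λ p → p false) ps))

-- The colouring is kept abstract because the layers are realised in two ways: offset by a square
-- root of ½ in dimension 9, by a diagonal step in dimension 11.
module TwoLayers (m : ℕ) (col : Bool → Vec ℕ 8 → ℕ) (col<m : ∀ l v → col l v < m)
  (same  : ∀ l v w → dist² v w ≡ 16 → col l v ≢ col l w)
  (cross : ∀ v w → dist² v w ≡ 8 → col false v ≢ col true w)
  where

  layerColours : Bool → List ℕ
  layerColours l = map (col l ∘ signed true) roots ++ map (col l ∘ signed false) roots

  colours : List ℕ
  colours = layerColours false ++ layerColours true

  module _ (c : ℕ) where

    class : Bool → Bool → Vec ℕ 8 → Bool
    class l s v = c ≡ᵇ col l (signed s v)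

    class-odd : ∀ l → AllPairs (OddOrConflict mod2 (class l)) roots
    class-odd l = AllPairs.map (Sum.map₂ λ far s t p r → same l _ _ (far s t) (same-class c p r)) roots-odd

    class-even : ∀ l → All (λ v → All (EvenOrConflict mod2 (class l) (class (not l)) v) roots) roots
    class-even false = All.map (All.map (EvenOrAt⇒EvenOrConflict signed signed (class false) (class true)
      λ s t d p r → cross _ _ d (same-class c p r))) roots-even
    class-even true  = All.map (λ {v} → All.map λ {w} →
      EvenOrAt⇒EvenOrConflict signed signed (class true) (class false) λ s t d p r →
        cross _ _ (trans (dist²-comm (signed t w) (signed s v)) d) (same-class c r p)) roots-even

    class-size : count (c ≡ᵇ_) colours ≤ 16
    class-size = subst (_≤ 16)
      (sym (trans (count-++ (c ≡ᵇ_) (layerColours false) (layerColours true))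
        (cong₂ _+_ (count-signed (c ≡ᵇ_) (λ s → col false ∘ signed s) roots)
                   (count-signed (c ≡ᵇ_) (λ s → col true ∘ signed s) roots))))
      (two-layer-bound mod2 (class false) (class true) roots-nonsingular
        (class-odd false) (class-odd true) (class-even false) (class-even true))

  All-colours : (P : ℕ → Set) → (∀ l → All (λ v → ∀ s → P (col l (signed s v))) roots) → All P colours
  All-colours P pointwise = All.++⁺ (layer false) (layer true)
    where
    layer : ∀ l → All P (layerColours l)
    layer l = All-signed P (λ s → col l ∘ signed s) roots (pointwise l)

  colours<m : All (_< m) colours
  colours<m = All-colours (_< m) λ l → All.universal (λ v s → col<m l (signed s v)) roots

  480≤m*16 : 480 ≤ m * 16
  480≤m*16 = pigeonhole m 16 colours colours<m class-size

  -- Each apex, repeated 16 times, fills a class that nothing else enters, so the weighted count is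
  -- 16 + 16 + 480 = 512.
  two-cones : ∀ a b → a < m → b < m → a ≢ b →
    (∀ l → All (λ v → ∀ s → a ≢ col l (signed s v)) roots) →
    (∀ l → All (λ v → ∀ s → b ≢ col l (signed s v)) roots) → 512 ≤ m * 16
  two-cones a b a<m b<m a≢b a-apart b-apart = pigeonhole m 16 (replicate 16 a ++ replicate 16 b ++ colours)
    (All.++⁺ (All.replicate⁺ 16 a<m) (All.++⁺ (All.replicate⁺ 16 b<m) colours<m))
    (cone-class-size 16 a (All.++⁺ (All.replicate⁺ 16 a≢b) (All-colours (a ≢_) a-apart))
      (cone-class-size 16 b (All-colours (b ≢_) b-apart) class-size))

module E₈Subgraph (m : ℕ) (col : Vec ℕ 8 → ℕ) (col<m : ∀ v → col v < m)
  (proper : ∀ v w → dist² v w ≡ 16 → col v ≢ col w) where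

  rootColours raisedColours spinorColours colours : List ℕ
  rootColours   = map (col ∘ signed true) roots₇ ++ map (col ∘ signed false) roots₇
  raisedColours = map (col ∘ raised true) roots₇ ++ map (col ∘ raised false) roots₇
  spinorColours = map col spinors
  colours       = rootColours ++ (raisedColours ++ spinorColours)

  module _ (c : ℕ) where

    class : (Bool → Vec ℕ 8 → Vec ℕ 8) → Bool → Vec ℕ 8 → Bool
    class p s v = c ≡ᵇ col (p s v)

    spinorClass : Vec ℕ 8 → Bool
    spinorClass v = c ≡ᵇ col v

    spinorVectors : List (Vec Bool 8)
    spinorVectors = map mod2 (filterᵇ spinorClass spinors)

    class-odd : ∀ p → AllPairs (OddOrFar p) roots₇ → AllPairs (OddOrConflict mod2 (class p)) roots₇
    class-odd p = AllPairs.map (Sum.map₂ λ far s t a b → proper _ _ (far s t) (same-class c a b))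

    class-even : ∀ p p′ → All (λ v → All (EvenOrAt 16 p p′ v) roots₇) roots₇ →
      All (λ v → All (EvenOrConflict mod2 (class p) (class p′) v) roots₇) roots₇
    class-even p p′ = All.map (All.map (EvenOrAt⇒EvenOrConflict p p′ (class p) (class p′)
      λ s t d a b → proper _ _ d (same-class c a b)))

    spinor-Clique : Clique spinorVectors
    spinor-Clique = AllPairs.map⁺ (All-pairs-with
      (λ { (inj₁ a) _ _ → a ; (inj₂ far) a b → ⊥-elim (proper _ _ far (same-class c a b)) })
      (AllPairs.filter⁺ (T? ∘ spinorClass) spinors-odd) (All.all-filter (T? ∘ spinorClass) spinors))

    -- Even pairs are at distance 16 for both signs of the root, so one sign in the class suffices;
    -- this serves both `some` and `both` as P.
    spinor-Adj : ∀ p → OddToSpinors p → (P : Vec ℕ 8 → Bool) →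
      (∀ v → T (P v) → ∃ λ s → T (class p s v)) →
      All (λ v → All (Adj v) spinorVectors) (map mod2 (filterᵇ P roots₇))
    spinor-Adj p odd P signOf = All.map⁺ (All.zipWith
      (λ {v} (tv , o) → All.map⁺ (All.zipWith
        (λ { (tc , inj₁ a)   → a
           ; (tc , inj₂ far) → let s , a = signOf v tv in ⊥-elim (proper _ _ (far s) (same-class c a tc)) })
        (All.all-filter (T? ∘ spinorClass) spinors , All.filter⁺ (T? ∘ spinorClass) o)))
      (All.all-filter (T? ∘ P) roots₇ , All.filter⁺ (T? ∘ P) odd))

    Q Q′ : Bool → Vec ℕ 8 → Bool
    Q  = class signed
    Q′ = class raised

    -- The raised roots with both signs are anticomplete to the unraised ones but adjacent to the
    -- spinors, so `clique-pair-bound` does not apply to them directly. Passing to sums b ⊕ u gives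
    -- up one vector b, hence 9 in place of 8.
    raised-third-lines :
      count (both Q′) roots₇ + (count (some Q) roots₇ + count spinorClass spinors) ≤ 9
    raised-third-lines = subst (_≤ 9)
      (cong₂ _+_ (length-map mod2 (filterᵇ (both Q′) roots₇))
        (cong₂ _+_ (length-map mod2 (filterᵇ (some Q) roots₇)) (length-map mod2 (filterᵇ spinorClass spinors))))
      (third-line-bound (both-vectors mod2 Q′ roots₇) (some-vectors mod2 Q roots₇) spinorVectors
        (All.map⁺ (All.filter⁺ (T? ∘ both Q′) roots₇-nonsingular))
        (All.map⁺ (All.filter⁺ (T? ∘ some Q) roots₇-nonsingular))
        (All.map⁺ (All.filter⁺ (T? ∘ spinorClass) spinors-nonsingular))
        (both-Clique mod2 Q′ (class-odd raised roots₇-odd-raised))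
        (some-Clique mod2 Q (class-odd signed roots₇-odd))
        spinor-Clique
        (spinor-Adj signed roots₇-spinors (some Q) (λ v → some-sign Q))
        (both-some-Anticomplete mod2 Q′ Q (class-even raised signed roots₇-even-raised))
        (spinor-Adj raised roots₇-spinors-raised (both Q′) (λ v t → true , both-signs Q′ t true)))

    class-size : count (c ≡ᵇ_) colours ≤ 17
    class-size = begin
      count (c ≡ᵇ_) colours
        ≡⟨ trans (count-++ (c ≡ᵇ_) rootColours (raisedColours ++ spinorColours))
             (cong (count (c ≡ᵇ_) rootColours +_) (count-++ (c ≡ᵇ_) raisedColours spinorColours)) ⟩
      count (c ≡ᵇ_) rootColours + (count (c ≡ᵇ_) raisedColours + count (c ≡ᵇ_) spinorColours)
        ≡⟨ cong₂ _+_ (trans (count-signed (c ≡ᵇ_) (λ s → col ∘ signed s) roots₇)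
                            (count-∨-∧ (Q true) (Q false) roots₇))
             (cong₂ _+_ (trans (count-signed (c ≡ᵇ_) (λ s → col ∘ raised s) roots₇)
                               (count-∨-∧ (Q′ true) (Q′ false) roots₇))
                        (count-map (c ≡ᵇ_) col spinors)) ⟩
      (x + p) + ((y + r) + k)
        -- The doubled raised roots r go with x and k under the bound 9, the doubled unraised roots
        -- p with y under the bound 8.
        ≡⟨ solve 5 (λ x p y r k → (x :+ p) :+ ((y :+ r) :+ k) := (r :+ (x :+ k)) :+ (p :+ y)) refl x p y r k ⟩
      (r + (x + k)) + (p + y)
        ≤⟨ +-mono-≤ raised-third-lines (cross-bound mod2 Q Q′ roots₇-nonsingular
             (class-odd signed roots₇-odd) (class-odd raised roots₇-odd-raised)
             (class-even signed raised roots₇-even)) ⟩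
      17 ∎
      where
      open ≤-Reasoning
      open +-*-Solver
      x p y r k : ℕ
      x = count (some Q) roots₇
      p = count (both Q) roots₇
      y = count (some Q′) roots₇
      r = count (both Q′) roots₇
      k = count spinorClass spinors

  308≤m*17 : 308 ≤ m * 17
  308≤m*17 = pigeonhole m 17 colours
    (All.++⁺ (bounded signed) (All.++⁺ (bounded raised)
      (All.map⁺ {f = col} (All.universal col<m spinors)))) class-size
    where
    bounded : (p : Bool → Vec ℕ 8 → Vec ℕ 8) →
      All (_< m) (map (col ∘ p true) roots₇ ++ map (col ∘ p false) roots₇)
    bounded p = All-signed (_< m) (λ s → col ∘ p s) roots₇ (All.universal (λ v s → col<m (p s v)) roots₇)

-- Arithmetic in a complete ordered field.

module OrderedField (R : CompleteOrderedField) where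

  open CompleteOrderedField R public
    renaming (_+_ to infixl 6 _+ᴿ_; _*_ to infixl 7 _*ᴿ_; -_ to infix 8 -ᴿ_; _≤_ to infix 4 _≤ᴿ_;
              +-mono-≤ to +ᴿ-mono-≤ᴿ)
  open IsTotalOrder isTotalOrder using (antisym)
    renaming (total to ≤ᴿ-total; trans to ≤ᴿ-trans; refl to ≤ᴿ-refl)

  ring : CommutativeRing _ _
  ring = record { isCommutativeRing = isCommutativeRing }

  open CommutativeRing ring
    using (-‿inverseʳ; distribˡ; zeroʳ; commutativeSemiring)
    renaming (+-comm to +ᴿ-comm; +-assoc to +ᴿ-assoc; *-comm to *ᴿ-comm;
              +-identityˡ to +ᴿ-identityˡ; +-identityʳ to +ᴿ-identityʳ; *-identityˡ to *ᴿ-identityˡ; *-identityʳ to *ᴿ-identityʳ)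
    public
  open Algebra.Properties.Ring (CommutativeRing.ring ring) public
  open Algebra.Solver.Ring.NaturalCoefficients.Default commutativeSemiring public

  -- Writing an inequality as x + e = y with e nonnegative removes negation, so the later identities
  -- are semiring identities.
  difference : ∀ {x y} → x ≤ᴿ y → Σ Carrier λ e → 0# ≤ᴿ e × x +ᴿ e ≡ y
  difference {x} {y} x≤y = y +ᴿ -ᴿ x
    , subst (_≤ᴿ y +ᴿ -ᴿ x) (-‿inverseʳ x) (+ᴿ-mono-≤ᴿ x y (-ᴿ x) x≤y)
    , trans (+ᴿ-comm x _) (trans (+ᴿ-assoc y (-ᴿ x) x)
        (trans (cong (y +ᴿ_) (trans (+ᴿ-comm (-ᴿ x) x) (-‿inverseʳ x))) (+ᴿ-identityʳ y)))

  x≤x+y : ∀ x {y} → 0# ≤ᴿ y → x ≤ᴿ x +ᴿ y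
  x≤x+y x {y} 0≤y = subst₂ _≤ᴿ_ (+ᴿ-identityˡ x) (+ᴿ-comm y x) (+ᴿ-mono-≤ᴿ 0# y x 0≤y)

  +ᴿ-mono : ∀ {x y z w} → x ≤ᴿ y → z ≤ᴿ w → x +ᴿ z ≤ᴿ y +ᴿ w
  +ᴿ-mono {x} {y} {z} {w} x≤y z≤w = ≤ᴿ-trans (+ᴿ-mono-≤ᴿ x y z x≤y)
    (subst₂ _≤ᴿ_ (+ᴿ-comm z y) (+ᴿ-comm w y) (+ᴿ-mono-≤ᴿ z w y z≤w))

  +ᴿ-cancelʳ-≤ : ∀ {x y} z → x +ᴿ z ≤ᴿ y +ᴿ z → x ≤ᴿ y
  +ᴿ-cancelʳ-≤ {x} {y} z p = subst₂ _≤ᴿ_ (undo x) (undo y) (+ᴿ-mono-≤ᴿ _ _ (-ᴿ z) p)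
    where
    undo : ∀ v → v +ᴿ z +ᴿ -ᴿ z ≡ v
    undo v = trans (+ᴿ-assoc v z (-ᴿ z)) (trans (cong (v +ᴿ_) (-‿inverseʳ z)) (+ᴿ-identityʳ v))

  *ᴿ-monoʳ : ∀ {a x y} → 0# ≤ᴿ a → x ≤ᴿ y → a *ᴿ x ≤ᴿ a *ᴿ y
  *ᴿ-monoʳ {a} {x} 0≤a x≤y with difference x≤y
  ... | e , 0≤e , refl = subst (a *ᴿ x ≤ᴿ_) (sym (distribˡ a x e)) (x≤x+y (a *ᴿ x) (*-nonneg a e 0≤a 0≤e))

  x*y≤x : ∀ {x y} → 0# ≤ᴿ x → y ≤ᴿ 1# → x *ᴿ y ≤ᴿ x
  x*y≤x {x} 0≤x y≤1 = subst (x *ᴿ _ ≤ᴿ_) (*ᴿ-identityʳ x) (*ᴿ-monoʳ 0≤x y≤1)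

  0≤1 : 0# ≤ᴿ 1#
  0≤1 with ≤ᴿ-total 0# 1#
  ... | inj₁ p = p
  ... | inj₂ 1≤0 with difference 1≤0
  -- Here e = -1 is nonnegative, hence so is its square 1.
  ...   | e , 0≤e , 1+e≡0 = subst (0# ≤ᴿ_) e*e≡1 (*-nonneg e e 0≤e 0≤e)
    where
    e*e≡1 : e *ᴿ e ≡ 1#
    e*e≡1 = begin
      e *ᴿ e                               ≡⟨ +ᴿ-identityʳ _ ⟨
      e *ᴿ e +ᴿ 0#                         ≡⟨ cong (e *ᴿ e +ᴿ_) (sym 1+e≡0) ⟩
      e *ᴿ e +ᴿ (1# +ᴿ e)                  ≡⟨ cong (λ o → e *ᴿ e +ᴿ (1# +ᴿ o)) (sym (*ᴿ-identityˡ e)) ⟩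
      e *ᴿ e +ᴿ (1# +ᴿ 1# *ᴿ e)            ≡⟨ solve 2 (λ e o → e :* e :+ (o :+ o :* e) := (o :+ e) :* e :+ o) refl e 1# ⟩
      (1# +ᴿ e) *ᴿ e +ᴿ 1#                 ≡⟨ cong (λ z → z *ᴿ e +ᴿ 1#) 1+e≡0 ⟩
      0# *ᴿ e +ᴿ 1#                        ≡⟨ cong (_+ᴿ 1#) (trans (*ᴿ-comm 0# e) (zeroʳ e)) ⟩
      0# +ᴿ 1#                             ≡⟨ +ᴿ-identityˡ 1# ⟩
      1#                                   ∎
      where open ≡-Reasoning

  1≰0 : 1# ≤ᴿ 0# → ⊥
  1≰0 1≤0 = nontrivial (antisym 0≤1 1≤0)

  ι : ℕ → Carrier
  ι zero    = 0#
  ι (suc n) = 1# +ᴿ ι n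

  ι-+ : ∀ m n → ι (m + n) ≡ ι m +ᴿ ι n
  ι-+ zero    n = sym (+ᴿ-identityˡ _)
  ι-+ (suc m) n = trans (cong (1# +ᴿ_) (ι-+ m n)) (sym (+ᴿ-assoc _ _ _))

  ι-* : ∀ m n → ι (m * n) ≡ ι m *ᴿ ι n
  ι-* zero    n = sym (trans (*ᴿ-comm 0# (ι n)) (zeroʳ (ι n)))
  ι-* (suc m) n = trans (ι-+ n (m * n)) (trans (cong (ι n +ᴿ_) (ι-* m n))
    (trans (cong (_+ᴿ ι m *ᴿ ι n) (sym (*ᴿ-identityˡ (ι n))))
      (solve 3 (λ o a b → o :* b :+ a :* b := (o :+ a) :* b) refl 1# (ι m) (ι n))))

  0≤ι : ∀ n → 0# ≤ᴿ ι n
  0≤ι zero    = ≤ᴿ-refl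
  0≤ι (suc n) = ≤ᴿ-trans 0≤1 (x≤x+y 1# (0≤ι n))

  -- The denominator is n + 1, so `reciprocal 2` is one third and `reciprocal 3` one quarter.
  reciprocal : ∀ n → Σ Carrier λ y → ι (suc n) *ᴿ y ≡ 1# × 0# ≤ᴿ y
  reciprocal n = y , xy≡1 , 0≤y
    where
    x≢0 : ι (suc n) ≢ 0#
    x≢0 x≡0 = 1≰0 (subst (1# ≤ᴿ_) x≡0 (x≤x+y 1# (0≤ι n)))
    y : Carrier
    y = proj₁ (inverse (ι (suc n)) x≢0)
    xy≡1 : ι (suc n) *ᴿ y ≡ 1#
    xy≡1 = proj₂ (inverse (ι (suc n)) x≢0)
    0≤y : 0# ≤ᴿ y
    0≤y with ≤ᴿ-total 0# y
    ... | inj₁ p   = p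
    ... | inj₂ y≤0 = ⊥-elim (1≰0 (subst₂ _≤ᴿ_ xy≡1 (zeroʳ _) (*ᴿ-monoʳ (0≤ι (suc n)) y≤0)))

  -- Square roots of elements of [0, 1] from least upper bounds.

  module _ {h : Carrier} (0≤h : 0# ≤ᴿ h) (h≤1 : h ≤ᴿ 1#) (no-root : ∀ s → s *ᴿ s ≢ h) where

    private
      S : Carrier → Set
      S x = x *ᴿ x ≤ᴿ h

      0∈S : S 0#
      0∈S = subst (_≤ᴿ h) (sym (zeroʳ 0#)) 0≤h

      S≤1 : ∀ x → S x → x ≤ᴿ 1#
      S≤1 x x²≤h with ≤ᴿ-total x 1#
      ... | inj₁ p   = p
      ... | inj₂ 1≤x = ≤ᴿ-trans (subst (_≤ᴿ x *ᴿ x) (*ᴿ-identityʳ x) (*ᴿ-monoʳ (≤ᴿ-trans 0≤1 1≤x) 1≤x))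
                         (≤ᴿ-trans x²≤h h≤1)

      sup : Σ Carrier λ s → (∀ x → S x → x ≤ᴿ s) × (∀ b → (∀ x → S x → x ≤ᴿ b) → s ≤ᴿ b)
      sup = lub S (0# , 0∈S) (1# , S≤1)

      s : Carrier
      s = proj₁ sup

      upper : ∀ x → S x → x ≤ᴿ s
      upper = proj₁ (proj₂ sup)

      least : ∀ b → (∀ x → S x → x ≤ᴿ b) → s ≤ᴿ b
      least = proj₂ (proj₂ sup)

      0≤s : 0# ≤ᴿ s
      0≤s = upper 0# 0∈S

      s≤1 : s ≤ᴿ 1#
      s≤1 = least 1# S≤1

      -- Thirds are used because (s + δ)² exceeds s² by the three products δs, δs and δδ, each at
      -- most δ when s and δ are at most 1.
      third : ∀ e → 0# ≤ᴿ e → Σ Carrier λ δ → 0# ≤ᴿ δ × δ +ᴿ (δ +ᴿ δ) ≡ e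
      third e 0≤e = t *ᴿ e , *-nonneg t e 0≤t 0≤e , (begin
        t *ᴿ e +ᴿ (t *ᴿ e +ᴿ t *ᴿ e)  ≡⟨ solve 2 (λ t e → t :* e :+ (t :* e :+ t :* e) := (t :+ (t :+ t)) :* e) refl t e ⟩
        (t +ᴿ (t +ᴿ t)) *ᴿ e          ≡⟨ cong (_*ᴿ e) 3t≡1 ⟩
        1# *ᴿ e                       ≡⟨ *ᴿ-identityˡ e ⟩
        e                             ∎)
        where
        open ≡-Reasoning
        t = proj₁ (reciprocal 2)
        0≤t = proj₂ (proj₂ (reciprocal 2))
        3t≡1 : t +ᴿ (t +ᴿ t) ≡ 1#
        3t≡1 = begin
          t +ᴿ (t +ᴿ t)                          ≡⟨ cong₂ _+ᴿ_ (1t t) (cong₂ _+ᴿ_ (1t t) (1t t)) ⟩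
          1# *ᴿ t +ᴿ (1# *ᴿ t +ᴿ 1# *ᴿ t)        ≡⟨ solve 2 (λ o t → o :* t :+ (o :* t :+ o :* t) := (o :+ (o :+ (o :+ con 0))) :* t) refl 1# t ⟩
          ι 3 *ᴿ t                               ≡⟨ proj₁ (proj₂ (reciprocal 2)) ⟩
          1#                                     ∎
          where
          1t : ∀ t → t ≡ 1# *ᴿ t
          1t t = sym (*ᴿ-identityˡ t)

      δ≤e : ∀ {δ e} → 0# ≤ᴿ δ → δ +ᴿ (δ +ᴿ δ) ≡ e → δ ≤ᴿ e
      δ≤e {δ} 0≤δ refl = x≤x+y δ (≤ᴿ-trans 0≤δ (x≤x+y δ 0≤δ))

      e≡0 : ∀ {δ e} → 0# ≤ᴿ δ → δ ≤ᴿ 0# → δ +ᴿ (δ +ᴿ δ) ≡ e → e ≡ 0#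
      e≡0 0≤δ δ≤0 refl with antisym 0≤δ δ≤0
      ... | refl = trans (+ᴿ-identityˡ _) (+ᴿ-identityˡ _)

      -- With δ = (h - s²)/3 the square of s + δ is still at most h, so s + δ ≤ s; then δ and e
      -- vanish and s is a root.
      s-too-small : ∀ e δ → s *ᴿ s +ᴿ e ≡ h → 0# ≤ᴿ δ → δ +ᴿ (δ +ᴿ δ) ≡ e → ⊥
      s-too-small e δ s²+e≡h 0≤δ 3δ≡e = no-root s (trans (sym (+ᴿ-identityʳ _))
        (trans (cong (s *ᴿ s +ᴿ_) (sym (e≡0 0≤δ δ≤0 3δ≡e))) s²+e≡h))
        where
        δ≤1 : δ ≤ᴿ 1#
        δ≤1 = ≤ᴿ-trans (δ≤e 0≤δ 3δ≡e) (≤ᴿ-trans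
          (subst (e ≤ᴿ_) (trans (+ᴿ-comm e _) s²+e≡h) (x≤x+y e (*-nonneg s s 0≤s 0≤s))) h≤1)
        [s+δ]∈S : S (s +ᴿ δ)
        [s+δ]∈S = subst₂ _≤ᴿ_
          (solve 2 (λ s d → s :* s :+ (d :* s :+ (d :* s :+ d :* d)) := (s :+ d) :* (s :+ d)) refl s δ)
          (trans (cong (s *ᴿ s +ᴿ_) 3δ≡e) s²+e≡h)
          (+ᴿ-mono (≤ᴿ-refl {s *ᴿ s}) (+ᴿ-mono (x*y≤x 0≤δ s≤1) (+ᴿ-mono (x*y≤x 0≤δ s≤1) (x*y≤x 0≤δ δ≤1))))
        δ≤0 : δ ≤ᴿ 0#
        δ≤0 = +ᴿ-cancelʳ-≤ s (subst₂ _≤ᴿ_ (+ᴿ-comm s δ) (sym (+ᴿ-identityˡ s)) (upper (s +ᴿ δ) [s+δ]∈S))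

      s²≤h-absurd : s *ᴿ s ≤ᴿ h → ⊥
      s²≤h-absurd s²≤h =
        let e , 0≤e , s²+e≡h = difference s²≤h
            δ , 0≤δ , 3δ≡e   = third e 0≤e
        in s-too-small e δ s²+e≡h 0≤δ 3δ≡e

      -- With u = s - δ, an x in S above u would force u² ≤ h and so s² ≤ h + 2δ, against s² = h +
      -- 3δ unless δ = 0. Hence u is an upper bound and s ≤ u, which again gives δ = 0.
      s-too-large : ∀ e δ u → h +ᴿ e ≡ s *ᴿ s → 0# ≤ᴿ δ → δ +ᴿ (δ +ᴿ δ) ≡ e → 0# ≤ᴿ u → δ +ᴿ u ≡ s → ⊥
      s-too-large e δ u h+e≡s² 0≤δ 3δ≡e 0≤u δ+u≡s = absurd (+ᴿ-cancelʳ-≤ u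
        (subst₂ _≤ᴿ_ (sym δ+u≡s) (sym (+ᴿ-identityˡ u)) (least u u-upper)))
        where
        absurd : δ ≤ᴿ 0# → ⊥
        absurd δ≤0 = no-root s (trans (sym h+e≡s²)
          (trans (cong (h +ᴿ_) (e≡0 0≤δ δ≤0 3δ≡e)) (+ᴿ-identityʳ h)))
        u≤1 : u ≤ᴿ 1#
        u≤1 = ≤ᴿ-trans (subst (u ≤ᴿ_) (trans (+ᴿ-comm u δ) δ+u≡s) (x≤x+y u 0≤δ)) s≤1
        s²≤ : u *ᴿ u ≤ᴿ h → s *ᴿ s ≤ᴿ h +ᴿ (δ +ᴿ δ)
        s²≤ u²≤h = subst (_≤ᴿ h +ᴿ (δ +ᴿ δ)) (trans
          (solve 2 (λ d u → u :* u :+ (d :* u :+ d :* (d :+ u)) := (d :+ u) :* (d :+ u)) refl δ u)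
          (cong₂ _*ᴿ_ δ+u≡s δ+u≡s))
          (+ᴿ-mono u²≤h (+ᴿ-mono (x*y≤x 0≤δ u≤1) (x*y≤x 0≤δ (subst (_≤ᴿ 1#) (sym δ+u≡s) s≤1))))
        u-upper : ∀ x → S x → x ≤ᴿ u
        u-upper x x²≤h with ≤ᴿ-total x u
        ... | inj₁ x≤u = x≤u
        ... | inj₂ u≤x = ⊥-elim (absurd (+ᴿ-cancelʳ-≤ (h +ᴿ (δ +ᴿ δ)) (subst₂ _≤ᴿ_
          (trans (sym h+e≡s²) (trans (cong (h +ᴿ_) (sym 3δ≡e))
            (solve 2 (λ h d → h :+ (d :+ (d :+ d)) := d :+ (h :+ (d :+ d))) refl h δ)))
          (sym (+ᴿ-identityˡ _))
          (s²≤ (≤ᴿ-trans (*ᴿ-monoʳ 0≤u u≤x) (≤ᴿ-trans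
            (subst (_≤ᴿ x *ᴿ x) (*ᴿ-comm x u) (*ᴿ-monoʳ (≤ᴿ-trans 0≤u u≤x) u≤x)) x²≤h))))))

      h≤s²-absurd : h ≤ᴿ s *ᴿ s → ⊥
      h≤s²-absurd h≤s² =
        let e , 0≤e , h+e≡s² = difference h≤s²
            δ , 0≤δ , 3δ≡e   = third e 0≤e
            -- The chain δ ≤ e ≤ s² ≤ s makes u = s - δ nonnegative.
            u , 0≤u , δ+u≡s  = difference (≤ᴿ-trans (δ≤e 0≤δ 3δ≡e) (≤ᴿ-trans
              (subst (e ≤ᴿ_) (trans (+ᴿ-comm e h) h+e≡s²) (x≤x+y e 0≤h)) (x*y≤x 0≤s s≤1)))
        in s-too-large e δ u h+e≡s² 0≤δ 3δ≡e 0≤u δ+u≡s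

    -- Refuting the absence of a root is enough, since dimension 9 uses the root only to reach a
    -- contradiction.
    no-square-root-absurd : ⊥
    no-square-root-absurd = [ s²≤h-absurd , h≤s²-absurd ]′ (≤ᴿ-total (s *ᴿ s) h)

-- The implicit argument is a numerical check: 18 · 17 = 306 < 308, 29 · 16 = 464 < 480 and 31 · 16
-- = 496 < 512.
too-few : ∀ {m} N j k → m < suc j → N ≤ m * k → {True (j * k <? N)} → ⊥
too-few N j k m≤j N≤mk {jk<N} =
  <⇒≱ (toWitness jk<N) (≤-trans N≤mk (*-monoˡ-≤ k (s≤s⁻¹ m≤j)))

-- Placing the lattice points in Euclidean space, and the bounds.

module UnitDistance (R : CompleteOrderedField) where

  open OrderedField R

  κ : Carrier
  κ = proj₁ (reciprocal 3)

  -- Scaling by ¼ turns squared distance 16 into 1.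
  place : Vec ℕ n → Fin n → Carrier
  place v i = κ *ᴿ ι (lookup v i)

  neg-square : ∀ x → (0# +ᴿ -ᴿ x) *ᴿ (0# +ᴿ -ᴿ x) ≡ x *ᴿ x
  neg-square x = begin
    (0# +ᴿ -ᴿ x) *ᴿ (0# +ᴿ -ᴿ x)  ≡⟨ cong₂ _*ᴿ_ (+ᴿ-identityˡ _) (+ᴿ-identityˡ _) ⟩
    -ᴿ x *ᴿ -ᴿ x                  ≡⟨ -‿distribˡ-* x (-ᴿ x) ⟨
    -ᴿ (x *ᴿ -ᴿ x)                ≡⟨ cong -ᴿ_ (sym (-‿distribʳ-* x x)) ⟩
    -ᴿ (-ᴿ (x *ᴿ x))              ≡⟨ -‿involutive _ ⟩
    x *ᴿ x                        ∎
    where open ≡-Reasoning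

  zero-square : ∀ x → (x +ᴿ -ᴿ x) *ᴿ (x +ᴿ -ᴿ x) ≡ 0#
  zero-square x = trans (cong ((x +ᴿ -ᴿ x) *ᴿ_) (-‿inverseʳ x)) (zeroʳ _)

  ι-difference² : ∀ m n → (ι m +ᴿ -ᴿ ι n) *ᴿ (ι m +ᴿ -ᴿ ι n) ≡ ι (∣ m - n ∣ * ∣ m - n ∣)
  ι-difference² zero    n       = trans (neg-square (ι n)) (sym (ι-* n n))
  ι-difference² (suc m) zero    = trans (cong₂ _*ᴿ_ minus-zero minus-zero) (sym (ι-* (suc m) (suc m)))
    where
    minus-zero : ι (suc m) +ᴿ -ᴿ 0# ≡ ι (suc m)
    minus-zero = trans (cong (ι (suc m) +ᴿ_) -0#≈0#) (+ᴿ-identityʳ _)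
  ι-difference² (suc m) (suc n) = trans (cong₂ _*ᴿ_ shift shift) (ι-difference² m n)
    where
    open ≡-Reasoning
    shift : (1# +ᴿ ι m) +ᴿ -ᴿ (1# +ᴿ ι n) ≡ ι m +ᴿ -ᴿ ι n
    shift = begin
      (1# +ᴿ ι m) +ᴿ -ᴿ (1# +ᴿ ι n)        ≡⟨ cong ((1# +ᴿ ι m) +ᴿ_) (sym (-‿+-comm 1# (ι n))) ⟩
      (1# +ᴿ ι m) +ᴿ (-ᴿ 1# +ᴿ -ᴿ ι n)     ≡⟨ solve 4 (λ a b c d → (a :+ b) :+ (c :+ d) := (a :+ c) :+ (b :+ d)) refl
                                                1# (ι m) (-ᴿ 1#) (-ᴿ ι n) ⟩
      (1# +ᴿ -ᴿ 1#) +ᴿ (ι m +ᴿ -ᴿ ι n)     ≡⟨ cong (_+ᴿ (ι m +ᴿ -ᴿ ι n)) (-‿inverseʳ 1#) ⟩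
      0# +ᴿ (ι m +ᴿ -ᴿ ι n)                ≡⟨ +ᴿ-identityˡ _ ⟩
      ι m +ᴿ -ᴿ ι n                        ∎

  scaled-difference² : ∀ a b → (κ *ᴿ a +ᴿ -ᴿ (κ *ᴿ b)) *ᴿ (κ *ᴿ a +ᴿ -ᴿ (κ *ᴿ b)) ≡
    κ *ᴿ κ *ᴿ ((a +ᴿ -ᴿ b) *ᴿ (a +ᴿ -ᴿ b))
  scaled-difference² a b = trans (cong₂ _*ᴿ_ factor factor)
    (solve 2 (λ k d → (k :* d) :* (k :* d) := k :* k :* (d :* d)) refl κ (a +ᴿ -ᴿ b))
    where
    factor : κ *ᴿ a +ᴿ -ᴿ (κ *ᴿ b) ≡ κ *ᴿ (a +ᴿ -ᴿ b)
    factor = sym (x[y-z]≈xy-xz κ a b)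

  sqDist-place : (v w : Vec ℕ n) → sqDist R n (place v) (place w) ≡ κ *ᴿ κ *ᴿ ι (dist² v w)
  sqDist-place []       []       = sym (zeroʳ _)
  sqDist-place (x ∷ xs) (y ∷ ys) = begin
    _ ≡⟨ cong₂ _+ᴿ_ (trans (scaled-difference² (ι x) (ι y)) (cong (κ *ᴿ κ *ᴿ_) (ι-difference² x y)))
                    (sqDist-place xs ys) ⟩
    κ *ᴿ κ *ᴿ ι (∣ x - y ∣ * ∣ x - y ∣) +ᴿ κ *ᴿ κ *ᴿ ι (dist² xs ys)  ≡⟨ distribˡ (κ *ᴿ κ) _ _ ⟨
    κ *ᴿ κ *ᴿ (ι (∣ x - y ∣ * ∣ x - y ∣) +ᴿ ι (dist² xs ys))
      ≡⟨ cong (κ *ᴿ κ *ᴿ_) (ι-+ (∣ x - y ∣ * ∣ x - y ∣) (dist² xs ys)) ⟨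
    κ *ᴿ κ *ᴿ ι (dist² (x ∷ xs) (y ∷ ys))  ∎
    where open ≡-Reasoning

  κκ16≡1 : κ *ᴿ κ *ᴿ ι 16 ≡ 1#
  κκ16≡1 = begin
    κ *ᴿ κ *ᴿ ι 16             ≡⟨ cong (κ *ᴿ κ *ᴿ_) (ι-* 4 4) ⟩
    κ *ᴿ κ *ᴿ (ι 4 *ᴿ ι 4)     ≡⟨ solve 2 (λ k f → k :* k :* (f :* f) := (f :* k) :* (f :* k)) refl κ (ι 4) ⟩
    (ι 4 *ᴿ κ) *ᴿ (ι 4 *ᴿ κ)   ≡⟨ cong₂ _*ᴿ_ 4κ≡1 4κ≡1 ⟩
    1# *ᴿ 1#                   ≡⟨ *ᴿ-identityˡ 1# ⟩
    1#                         ∎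
    where
    open ≡-Reasoning
    4κ≡1 : ι 4 *ᴿ κ ≡ 1#
    4κ≡1 = proj₁ (proj₂ (reciprocal 3))

  place-adjacent : (v w : Vec ℕ n) → dist² v w ≡ 16 → UnitAdj R n (place v) (place w)
  place-adjacent v w d = trans (sqDist-place v w) (trans (cong (λ k → κ *ᴿ κ *ᴿ ι k) d) κκ16≡1)

  half : Carrier
  half = κ *ᴿ κ *ᴿ ι 8

  half+half≡1 : half +ᴿ half ≡ 1#
  half+half≡1 = trans (sym (distribˡ (κ *ᴿ κ) (ι 8) (ι 8))) (trans (cong (κ *ᴿ κ *ᴿ_) (sym (ι-+ 8 8))) κκ16≡1)

  0≤half : 0# ≤ᴿ half
  0≤half = *-nonneg _ _ (*-nonneg κ κ 0≤κ 0≤κ) (0≤ι 8)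
    where
    0≤κ : 0# ≤ᴿ κ
    0≤κ = proj₂ (proj₂ (reciprocal 3))

  half≤1 : half ≤ᴿ 1#
  half≤1 = subst (half ≤ᴿ_) half+half≡1 (x≤x+y half 0≤half)

  cons : ∀ {d} → Carrier → (Fin d → Carrier) → Fin (suc d) → Carrier
  cons a p zero    = a
  cons a p (suc i) = p i

  -- A colouring restricts to the hyperplane where the first coordinate is 0, and distances there
  -- are unchanged.
  embed : ∀ {d k} → ChromaticAtLeast R d k → ChromaticAtLeast R (suc d) k
  embed bound m m<k (f , proper) = bound m m<k (f ∘ cons 0# , λ p r adj →
    proper (cons 0# p) (cons 0# r) (trans (cong (_+ᴿ sqDist R _ p r) (zero-square 0#)) (trans (+ᴿ-identityˡ _) adj)))

  weaken : ∀ {d k j} → j ≤ k → ChromaticAtLeast R d k → ChromaticAtLeast R d j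
  weaken j≤k bound m m<j = bound m (≤-trans m<j j≤k)

  dimension-8 : ChromaticAtLeast R 8 19
  dimension-8 m m<19 (f , proper) = too-few 308 18 17 m<19 308≤m*17
    where
    open E₈Subgraph m (toℕ ∘ f ∘ place) (λ _ → toℕ<n _)
      (λ v w d → proper _ _ (place-adjacent v w d) ∘ toℕ-injective)

  -- The full strength 30 is kept because dimension 10 obtains its 26 from it by embedding.
  dimension-9 : ChromaticAtLeast R 9 30
  dimension-9 m m<30 (f , proper) = no-square-root-absurd 0≤half half≤1 λ σ σ²≡half →
    let open Layers σ σ²≡half in too-few 480 29 16 m<30 480≤m*16
    where
    module Layers (σ : Carrier) (σ²≡half : σ *ᴿ σ ≡ half) where
      height : Bool → Carrier
      height l = if l then σ else 0#

      same : ∀ l v w → dist² v w ≡ 16 → UnitAdj R 9 (cons (height l) (place v)) (cons (height l) (place w))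
      same l v w d = trans (cong₂ _+ᴿ_ (zero-square (height l)) (place-adjacent v w d)) (+ᴿ-identityˡ 1#)

      cross : ∀ v w → dist² v w ≡ 8 → UnitAdj R 9 (cons 0# (place v)) (cons σ (place w))
      cross v w d = trans (cong₂ _+ᴿ_ (trans (neg-square σ) σ²≡half)
        (trans (sqDist-place v w) (cong (λ k → κ *ᴿ κ *ᴿ ι k) d))) half+half≡1

      open TwoLayers m (λ l v → toℕ (f (cons (height l) (place v)))) (λ _ _ → toℕ<n _)
        (λ l v w d → proper _ _ (same l v w d) ∘ toℕ-injective)
        (λ v w d → proper _ _ (cross v w d) ∘ toℕ-injective) public

  dimension-11 : ChromaticAtLeast R 11 32
  dimension-11 m m<32 (f , proper) = too-few 512 31 16 m<32
    (two-cones (colour apex) (colour apex′) (toℕ<n _) (toℕ<n _) (adjacent-differ apex apex′ refl)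
      (λ l → All.map (λ {v} norm s → adjacent-differ apex (point l (signed s v)) (apex-distance l (signed s v) (norm s))) roots-norm)
      (λ l → All.map (λ {v} norm s → adjacent-differ apex′ (point l (signed s v)) (apex′-distance l (signed s v) (norm s))) roots-norm))
    where
    colour : Vec ℕ 11 → ℕ
    colour = toℕ ∘ f ∘ place

    adjacent-differ : ∀ v w → dist² v w ≡ 16 → colour v ≢ colour w
    adjacent-differ v w d = proper _ _ (place-adjacent v w d) ∘ toℕ-injective

    -- The diagonal step from (0, 0) to (2, 2) gives the layer offset 4 + 4 = 8 without a square
    -- root; the third coordinate leaves room for the apexes.
    point : Bool → Vec ℕ 8 → Vec ℕ 11
    point l v = (if l then 2 else 0) ∷ (if l then 2 else 0) ∷ 2 ∷ v

    -- (2, 0) is at squared distance 4 from both (0, 0) and (2, 2); the third coordinate adds 4 and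
    -- the root 8, in all 16. The apexes differ by 4 in the third coordinate, so they are adjacent
    -- too.
    apex apex′ : Vec ℕ 11
    apex  = 2 ∷ 0 ∷ 4 ∷ origin 8
    apex′ = 2 ∷ 0 ∷ 0 ∷ origin 8

    apex-distance : ∀ l v → dist² (origin 8) v ≡ 8 → dist² apex (point l v) ≡ 16
    apex-distance false v d = cong (8 +_) d
    apex-distance true  v d = cong (8 +_) d

    apex′-distance : ∀ l v → dist² (origin 8) v ≡ 8 → dist² apex′ (point l v) ≡ 16
    apex′-distance false v d = cong (8 +_) d
    apex′-distance true  v d = cong (8 +_) d

    same-distance : ∀ l v w → dist² v w ≡ 16 → dist² (point l v) (point l w) ≡ 16
    same-distance false v w d = d
    same-distance true  v w d = d

    open TwoLayers m (λ l → colour ∘ point l) (λ _ _ → toℕ<n _)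
      (λ l v w d → adjacent-differ (point l v) (point l w) (same-distance l v w d))
      (λ v w d → adjacent-differ (point false v) (point true w) (cong (8 +_) d))

mainTheorem1 : (R : CompleteOrderedField) →
    ChromaticAtLeast R 8 19 × ChromaticAtLeast R 9 21 ×
    ChromaticAtLeast R 10 26 × ChromaticAtLeast R 11 32 ×
    ChromaticAtLeast R 12 32
mainTheorem1 R =
    dimension-8
  , weaken (toWitness {a? = 21 ≤? 30} _) dimension-9
  , weaken (toWitness {a? = 26 ≤? 30} _) (embed dimension-9)
  , dimension-11
  , embed dimension-11
  where open UnitDistance R
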